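{- Let $d$ and $s$ be integers with $1\le s\le d/2$. There exists $n_0$ (depending only on $d$ and $s$) such that for every $n\ge n_0$ the following holds. If $\mathcal F\subseteq \binom{[n]}{d+1}$ is an $s$-witness family, then $|\mathcal F|\le \binom{n-1}{d}$. Moreover, if $|\mathcal F|=\binom{n-1}{d}$, then $\mathcal F$ is a star, i.e. there exists $x_0\in[n]$ with $\mathcal F=\{F\in\binom{[n]}{d+1}: x_0\in F\}$.
   Context: $[n]=\{1,\dots,n\}$ and $\binom{[n]}{k}$ denotes the family of $k$-element subsets of $[n]$. For $n\ge d+1$ and $0\le s\le d$, a family $\mathcal F\subseteq\binom{[n]}{d+1}$ is an $s$-witness family if for every $F\in\mathcal F$ there exists $B_F\subseteq F$ with $|B_F|=s$ such that $F\cap F'\neq B_F$ for every $F'\in\mathcal F$. A star is a family of the form $\{F\in\binom{[n]}{d+1}: x_0\in F\}$ for some $x_0\in[n]$. -}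

module Defs where

open import Data.Nat using (ℕ; suc)
open import Data.Fin using (Fin)
open import Data.Fin.Subset using (Subset; _∈_; _⊆_; _∩_; ∣_∣)
open import Data.List using (List)
open import Data.List.Relation.Unary.Unique.Propositional using (Unique)
import Data.List.Membership.Propositional as LM
open import Data.Product using (Σ; _×_; ∃)
open import Relation.Binary.PropositionalEquality using (_≡_; _≢_)
open import Function.Bundles using (_⇔_)

-- A family 𝓕 ⊆ binom([n], d+1): a duplicate-free list of subsets of Fin n
-- (Fin n stands for [n]), each of cardinality d+1.  |𝓕| = length of the list.
record UniformFamily (n k : ℕ) : Set where
  field
    members : List (Subset n)
    unique  : Unique members
    uniform : ∀ F → F LM.∈ members → ∣ F ∣ ≡ k
open UniformFamily public

IsWitnessFamily : ∀ {n k} → ℕ → UniformFamily n k → Set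
IsWitnessFamily {n} s 𝓕 =
  ∀ F → F LM.∈ members 𝓕 →
    Σ (Subset n) λ B → B ⊆ F × ∣ B ∣ ≡ s ×
      (∀ F′ → F′ LM.∈ members 𝓕 → (F ∩ F′) ≢ B)

IsStar : ∀ {n k} → UniformFamily n k → Set
IsStar {n} {k} 𝓕 =
  ∃ λ (x₀ : Fin n) → ∀ (F : Subset n) → (F LM.∈ members 𝓕 ⇔ (∣ F ∣ ≡ k × x₀ ∈ F))

{-# OPTIONS --safe #-}
-- Write k = d + 1 and let F have witness B_F.  Say that an s-set B forces y ∉ B if
-- every member of 𝓕 containing B contains y.  If B forces nothing, only
-- O(n^(d-s-1)) members have witness B.  If B_F forces y, then F - y lies in no
-- other member of 𝓕, so such F inject into the d-sets.
--
-- Assume |𝓕| ≥ C(n-1,d).  If every point x were forced by only O(n^(s-1)) s-sets,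
-- most pairs B, D of forcing sets would force different points x, y; as 2s ≤ d, a
-- positive proportion of all d-sets E would contain such a pair and miss x and y,
-- and no member of 𝓕 contains such an E.  But the injection above leaves only
-- O(n^(d-1)) d-sets not covered by 𝓕.
--
-- So some x is forced by at least L n^(s-1) s-sets, with L as large as we like.
-- Compare the members H missing x with the d-sets E missing x such that
-- E ∪ {x} ∉ 𝓕.  Those H whose witness forces a point y inject, by H ↦ H - y, into
-- the E that contain no set forcing x.  For each witness B of the other H there are
-- only O(n^(d-s-1)) such H, but E ∩ H = B makes E one of the d-sets above, and since
-- 2s ≤ d, many of these E contain a set forcing x.  Hence removing all H and
-- completing the star at x strictly enlarges 𝓕 unless 𝓕 is a star.

module Submission where

open import Defs
open import Data.Nat hiding (∣_-_∣)
open import Data.Nat.Properties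
open import Data.Nat.Combinatorics using (_C_; nCk+nC[k+1]≡[n+1]C[k+1])
open import Data.Nat.Tactic.RingSolver using (solve-∀)
open import Data.Fin as Fin using (Fin; zero; suc)
open import Data.Fin.Properties using (any?)
open import Data.Fin.Subset
open import Data.Fin.Subset.Properties
open import Data.Vec using ([]; _∷_; here; there)
open import Data.Vec.Properties using (≡-dec)
import Data.Bool.Properties as Bool
open import Data.List using (List; []; _∷_; _++_; map; allFin; length)
open import Data.List.Properties using (map-tabulate)
open import Data.List.Relation.Unary.Any using (here; there)
open import Data.List.Relation.Unary.All using (lookup)
open import Data.List.Relation.Unary.AllPairs using ([]; _∷_)
open import Data.List.Relation.Unary.Unique.Propositional using (Unique)
open import Data.List.Membership.Propositional using () renaming (_∈_ to _∈ₗ_)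
open import Data.List.Membership.Propositional.Properties using (∈-allFin; ∈-++⁺ˡ; ∈-++⁺ʳ; ∈-map⁺)
import Data.List.Membership.DecPropositional as DecMembership
open import Data.Product using (Σ; ∃; _×_; _,_; proj₁; proj₂)
open import Data.Sum using (_⊎_; inj₁; inj₂)
open import Function using (_∘_)
open import Function.Bundles using (mk⇔)
open import Relation.Nullary
open import Relation.Nullary.Decidable using (decidable-stable)
open import Relation.Unary using (Decidable)
open import Relation.Binary.PropositionalEquality

-- Finite sums, indicators and double counting

private variable
  A B X : Set

∑ : List A → (A → ℕ) → ℕ
∑ []       f = 0
∑ (a ∷ as) f = f a + ∑ as f

∑-mono : ∀ (as : List A) {f g : A → ℕ} → (∀ a → f a ≤ g a) → ∑ as f ≤ ∑ as g
∑-mono []       f≤g = z≤n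
∑-mono (a ∷ as) f≤g = +-mono-≤ (f≤g a) (∑-mono as f≤g)

∑-cong : ∀ (as : List A) {f g : A → ℕ} → (∀ a → f a ≡ g a) → ∑ as f ≡ ∑ as g
∑-cong []       f≡g = refl
∑-cong (a ∷ as) f≡g = cong₂ _+_ (f≡g a) (∑-cong as f≡g)

∑-zero : ∀ (as : List A) → ∑ as (λ _ → 0) ≡ 0
∑-zero []       = refl
∑-zero (a ∷ as) = ∑-zero as

∑-+ : ∀ (as : List A) (f g : A → ℕ) → ∑ as (λ a → f a + g a) ≡ ∑ as f + ∑ as g
∑-+ []       f g = refl
∑-+ (a ∷ as) f g = trans (cong ((f a + g a) +_) (∑-+ as f g)) (interchange (f a) (g a) _ _)
  where
  interchange : ∀ w x y z → (w + x) + (y + z) ≡ (w + y) + (x + z)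
  interchange = solve-∀

∑-*ʳ : ∀ (as : List A) (f : A → ℕ) c → ∑ as (λ a → f a * c) ≡ ∑ as f * c
∑-*ʳ []       f c = refl
∑-*ʳ (a ∷ as) f c = trans (cong (f a * c +_) (∑-*ʳ as f c)) (sym (*-distribʳ-+ c (f a) _))

∑-*ˡ : ∀ (as : List A) (f : A → ℕ) c → ∑ as (λ a → c * f a) ≡ c * ∑ as f
∑-*ˡ []       f c = sym (*-zeroʳ c)
∑-*ˡ (a ∷ as) f c = trans (cong (c * f a +_) (∑-*ˡ as f c)) (sym (*-distribˡ-+ c (f a) _))

∑-swap : ∀ (as : List A) (bs : List B) (f : A → B → ℕ) →
  ∑ as (λ a → ∑ bs (f a)) ≡ ∑ bs (λ b → ∑ as (λ a → f a b))
∑-swap []       bs f = sym (∑-zero bs)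
∑-swap (a ∷ as) bs f = trans (cong (∑ bs (f a) +_) (∑-swap as bs f)) (sym (∑-+ bs (f a) _))

∑-++ : ∀ (as bs : List A) (f : A → ℕ) → ∑ (as ++ bs) f ≡ ∑ as f + ∑ bs f
∑-++ []       bs f = refl
∑-++ (a ∷ as) bs f = trans (cong (f a +_) (∑-++ as bs f)) (sym (+-assoc (f a) _ _))

∑-map : ∀ (g : B → A) (bs : List B) (f : A → ℕ) → ∑ (map g bs) f ≡ ∑ bs (f ∘ g)
∑-map g []       f = refl
∑-map g (b ∷ bs) f = cong (f (g b) +_) (∑-map g bs f)

∑-lower : ∀ {a} {as : List A} (f : A → ℕ) → a ∈ₗ as → f a ≤ ∑ as f
∑-lower f (here refl) = m≤m+n _ _
∑-lower f (there a∈)  = m≤n⇒m≤o+n _ (∑-lower f a∈)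

ind : Dec X → ℕ
ind (yes _) = 1
ind (no  _) = 0

ind-mono : ∀ {X Y : Set} (X? : Dec X) (Y? : Dec Y) → (X → Y) → ind X? ≤ ind Y?
ind-mono (yes x) (yes y) f = ≤-refl
ind-mono (yes x) (no ¬y) f = contradiction (f x) ¬y
ind-mono (no _)  _       f = z≤n

ind-yes : (X? : Dec X) → X → ind X? ≡ 1
ind-yes (yes _) x = refl
ind-yes (no ¬x) x = contradiction x ¬x

ind-no : (X? : Dec X) → ¬ X → ind X? ≡ 0
ind-no (yes x) ¬x = contradiction x ¬x
ind-no (no _)  ¬x = refl

ind-≤ : (X? : Dec X) {k : ℕ} → (X → 1 ≤ k) → ind X? ≤ k
ind-≤ (yes x) f = f x
ind-≤ (no _)  f = z≤n

# : {P : A → Set} → List A → Decidable P → ℕ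
# as P? = ∑ as (λ a → ind (P? a))

#-mono : ∀ {P : A → Set} {Q : A → Set} (as : List A) (P? : Decidable P) (Q? : Decidable Q) →
  (∀ a → P a → Q a) → # as P? ≤ # as Q?
#-mono as P? Q? f = ∑-mono as (λ a → ind-mono (P? a) (Q? a) (f a))

#-⊎ : ∀ {P : A → Set} {Q : A → Set} {R : A → Set} (as : List A) (P? : Decidable P) (Q? : Decidable Q) (R? : Decidable R) →
  (∀ a → P a → Q a ⊎ R a) → # as P? ≤ # as Q? + # as R?
#-⊎ as P? Q? R? f = ≤-trans (∑-mono as pointwise) (≤-reflexive (∑-+ as _ _))
  where
  pointwise : ∀ a → ind (P? a) ≤ ind (Q? a) + ind (R? a)
  pointwise a with P? a
  ... | no _ = z≤n
  ... | yes p with f a p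
  ...   | inj₁ q rewrite ind-yes (Q? a) q = s≤s z≤n
  ...   | inj₂ r rewrite ind-yes (R? a) r = m≤n+m 1 (ind (Q? a))

#-disjoint : ∀ {P : A → Set} {Q : A → Set} {R : A → Set} (as : List A) (P? : Decidable P) (Q? : Decidable Q) (R? : Decidable R) →
  (∀ a → Q a → P a) → (∀ a → R a → P a) → (∀ a → Q a → ¬ R a) → # as Q? + # as R? ≤ # as P?
#-disjoint as P? Q? R? f g h = ≤-trans (≤-reflexive (sym (∑-+ as _ _))) (∑-mono as pointwise)
  where
  pointwise : ∀ a → ind (Q? a) + ind (R? a) ≤ ind (P? a)
  pointwise a with Q? a
  ... | no _  = ind-mono (R? a) (P? a) (g a)
  ... | yes q rewrite ind-no (R? a) (h a q) | ind-yes (P? a) (f a q) = ≤-refl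

#-witness : ∀ {P : A → Set} (as : List A) (P? : Decidable P) → (# as P? ≡ 0) ⊎ ∃ P
#-witness []       P? = inj₁ refl
#-witness (a ∷ as) P? with P? a
... | yes p = inj₂ (a , p)
... | no _  = #-witness as P?

#-positive : ∀ {P : A → Set} {a} {as : List A} (P? : Decidable P) → a ∈ₗ as → P a → 1 ≤ # as P?
#-positive {a = a} {as} P? a∈ p = ≤-trans (≤-reflexive (sym (ind-yes (P? a) p))) (∑-lower (λ a → ind (P? a)) a∈)

#-*-≤-∑ : ∀ {A : Set} {P : A → Set} (as : List A) (P? : Decidable P) (f : A → ℕ) u →
  (∀ a → P a → u ≤ f a) → # as P? * u ≤ ∑ as f
#-*-≤-∑ as P? f u lower = ≤-trans (≤-reflexive (sym (∑-*ʳ as _ u))) (∑-mono as weigh)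
  where
  weigh : ∀ a → ind (P? a) * u ≤ f a
  weigh a with P? a
  ... | yes p = ≤-trans (≤-reflexive (+-identityʳ u)) (lower a p)
  ... | no _  = z≤n

-- The total of the weights `f a b` is estimated by rows and by columns. Weights rather than a
-- relation allow `f` itself to be a sum over a third set.
double-count : ∀ {A B : Set} {P : A → Set} {Q : B → Set} (as : List A) (bs : List B)
  (P? : Decidable P) (Q? : Decidable Q) (f : A → B → ℕ) u v →
  (∀ a → P a → u ≤ ∑ bs (f a)) →
  (∀ b → ∑ as (λ a → f a b) ≤ ind (Q? b) * v) →
  # as P? * u ≤ # bs Q? * v
double-count as bs P? Q? f u v lower upper = begin
  # as P? * u                          ≤⟨ #-*-≤-∑ as P? _ u lower ⟩
  ∑ as (λ a → ∑ bs (f a))              ≡⟨ ∑-swap as bs f ⟩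
  ∑ bs (λ b → ∑ as (λ a → f a b))      ≤⟨ ∑-mono bs upper ⟩
  ∑ bs (λ b → ind (Q? b) * v)          ≡⟨ ∑-*ʳ bs _ v ⟩
  # bs Q? * v                          ∎
  where open ≤-Reasoning

-- Union bound: every `a` is charged to some related `b`, and no `b` is charged more than `M` times.
#-cover : ∀ {P : A → Set} {Q : B → Set} (as : List A) (bs : List B) {_~_ : A → B → Set} (P? : Decidable P) (S? : Decidable Q)
  (~? : ∀ a b → Dec (a ~ b)) M →
  (∀ a → P a → ∃ λ b → b ∈ₗ bs × Q b × a ~ b) →
  (∀ b → Q b → # as (λ a → P? a ×-dec ~? a b) ≤ M) →
  # as P? ≤ # bs S? * M
#-cover as bs P? S? ~? M meets bound = ≤-trans (≤-reflexive (sym (*-identityʳ _)))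
  (double-count as bs P? S? (λ a b → ind ((P? a ×-dec ~? a b) ×-dec S? b)) 1 M
    (λ a p → let (b , b∈ , q , a~b) = meets a p in
      ≤-trans (≤-reflexive (sym (ind-yes ((P? a ×-dec ~? a b) ×-dec S? b) ((p , a~b) , q)))) (∑-lower _ b∈))
    upper)
  where
  upper : ∀ b → ∑ as (λ a → ind ((P? a ×-dec ~? a b) ×-dec S? b)) ≤ ind (S? b) * M
  upper b with S? b
  ... | yes q = ≤-trans (∑-mono as (λ a → ind-mono _ (P? a ×-dec ~? a b) proj₁))
                  (≤-trans (bound b q) (≤-reflexive (sym (+-identityʳ M))))
  ... | no ¬q = ≤-reflexive (trans (∑-cong as (λ a → ind-no ((P? a ×-dec ~? a b) ×-dec no ¬q) (¬q ∘ proj₂))) (∑-zero as))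

-- Binomial coefficients and counting subsets

#-cong : ∀ {A : Set} {P Q : A → Set} (as : List A) (P? : Decidable P) (Q? : Decidable Q) →
  (∀ a → P a → Q a) → (∀ a → Q a → P a) → # as P? ≡ # as Q?
#-cong as P? Q? f g = ≤-antisym (#-mono as P? Q? f) (#-mono as Q? P? g)

#-empty : ∀ {A : Set} {P : A → Set} (as : List A) (P? : Decidable P) → (∀ a → ¬ P a) → # as P? ≡ 0
#-empty as P? ¬p with #-witness as P?
... | inj₁ e       = e
... | inj₂ (a , p) = contradiction p (¬p a)

nCk≤n^k : ∀ n k → n C k ≤ n ^ k
nCk≤n^k n       zero    = ≤-refl
nCk≤n^k zero    (suc k) = z≤n
nCk≤n^k (suc n) (suc k) = begin
  suc n C suc k              ≡⟨ sym (nCk+nC[k+1]≡[n+1]C[k+1] n k) ⟩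
  n C k + n C suc k          ≤⟨ +-mono-≤ (nCk≤n^k n k) (nCk≤n^k n (suc k)) ⟩
  suc n * n ^ k              ≤⟨ *-monoʳ-≤ (suc n) (^-monoˡ-≤ k (n≤1+n n)) ⟩
  suc n * suc n ^ k          ∎
  where open ≤-Reasoning

absorption : ∀ n k → suc k * (suc n C suc k) ≡ suc n * (n C k)
absorption zero    zero    = refl
absorption zero    (suc k) = *-zeroʳ k
absorption (suc n) zero    = begin
  1 * (suc (suc n) C 1)               ≡⟨ *-identityˡ _ ⟩
  suc (suc n) C 1                     ≡⟨ sym (nCk+nC[k+1]≡[n+1]C[k+1] (suc n) 0) ⟩
  1 + (suc n C 1)                     ≡⟨ cong suc (trans (sym (*-identityˡ _)) (absorption n 0)) ⟩
  suc (suc n * 1)                     ∎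
  where open ≡-Reasoning
absorption (suc n) (suc k) = begin
  suc (suc k) * (suc (suc n) C suc (suc k))
    ≡⟨ cong (suc (suc k) *_) (sym (nCk+nC[k+1]≡[n+1]C[k+1] (suc n) (suc k))) ⟩
  suc (suc k) * (c + (suc n C suc (suc k)))
    ≡⟨ expand k c (suc n C suc (suc k)) ⟩
  c + (suc k * c + suc (suc k) * (suc n C suc (suc k)))
    ≡⟨ cong (c +_) (cong₂ _+_ (absorption n k) (absorption n (suc k))) ⟩
  c + (suc n * (n C k) + suc n * (n C suc k))
    ≡⟨ cong (c +_) (sym (*-distribˡ-+ (suc n) (n C k) _)) ⟩
  c + suc n * (n C k + n C suc k)
    ≡⟨ cong (λ z → c + suc n * z) (nCk+nC[k+1]≡[n+1]C[k+1] n k) ⟩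
  c + suc n * c ∎
  where
  open ≡-Reasoning
  c = suc n C suc k
  expand : ∀ k c e → suc (suc k) * (c + e) ≡ c + (suc k * c + suc (suc k) * e)
  expand = solve-∀

-- Induction on `k`: by absorption each step multiplies the right side by n + k + 1, which is at
-- least `n`.
n^k≤k!*[n+k]Ck : ∀ n k → n ^ k ≤ k ! * ((n + k) C k)
n^k≤k!*[n+k]Ck n zero    = ≤-refl
n^k≤k!*[n+k]Ck n (suc k) = begin
  n * n ^ k                              ≤⟨ *-mono-≤ (m≤n⇒m≤1+n (m≤m+n n k)) (n^k≤k!*[n+k]Ck n k) ⟩
  suc (n + k) * (k ! * ((n + k) C k))    ≡⟨ swap (suc (n + k)) (k !) _ ⟩
  k ! * (suc (n + k) * ((n + k) C k))    ≡⟨ cong (k ! *_) (sym (absorption (n + k) k)) ⟩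
  k ! * (suc k * (suc (n + k) C suc k))  ≡⟨ assoc (k !) (suc k) _ ⟩
  suc k * k ! * (suc (n + k) C suc k)    ≡⟨ cong (λ z → suc k * k ! * (z C suc k)) (sym (+-suc n k)) ⟩
  suc k * k ! * ((n + suc k) C suc k)    ∎
  where
  open ≤-Reasoning
  swap : ∀ x y z → x * (y * z) ≡ y * (x * z)
  swap = solve-∀
  assoc : ∀ x y z → x * (y * z) ≡ y * x * z
  assoc = solve-∀

^-distribʳ-* : ∀ k m n → (m * n) ^ k ≡ m ^ k * n ^ k
^-distribʳ-* zero    m n = refl
^-distribʳ-* (suc k) m n = trans (cong (m * n *_) (^-distribʳ-* k m n)) (interchange m n (m ^ k) (n ^ k))
  where
  interchange : ∀ w x y z → w * x * (y * z) ≡ w * y * (x * z)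
  interchange = solve-∀

-- Loss factor in comparing n^k with C(r,k) when r - k is only known to be at least n/2.
Γ : ℕ → ℕ
Γ k = 2 ^ k * k !

n^k≤Γ*rCk : ∀ n r k → k + k + n ≤ r + r → n ^ k ≤ Γ k * (r C k)
n^k≤Γ*rCk n r k small = begin
  n ^ k                              ≤⟨ ^-monoˡ-≤ k n≤2p ⟩
  (2 * p) ^ k                        ≡⟨ ^-distribʳ-* k 2 p ⟩
  2 ^ k * p ^ k                      ≤⟨ *-monoʳ-≤ (2 ^ k) (n^k≤k!*[n+k]Ck p k) ⟩
  2 ^ k * (k ! * ((p + k) C k))      ≡⟨ sym (*-assoc (2 ^ k) (k !) _) ⟩
  Γ k * ((p + k) C k)                ≡⟨ cong (λ z → Γ k * (z C k)) (m∸n+n≡m k≤r) ⟩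
  Γ k * (r C k)                      ∎
  where
  open ≤-Reasoning
  p = r ∸ k
  k≤r : k ≤ r
  k≤r with k ≤? r
  ... | yes le = le
  ... | no k≰r = contradiction small (<⇒≱ (≤-trans (+-mono-< (≰⇒> k≰r) (≰⇒> k≰r)) (m≤m+n (k + k) n)))
  n≤2p : n ≤ 2 * p
  n≤2p = +-cancelˡ-≤ (k + k) n (2 * p) (≤-trans small (≤-reflexive
    (trans (sym (cong₂ _+_ (m∸n+n≡m k≤r) (m∸n+n≡m k≤r))) (arrange p k))))
    where
    arrange : ∀ p k → p + k + (p + k) ≡ k + k + 2 * p
    arrange = solve-∀

-- Enumerating and counting the subsets of [n]

subsets : ∀ n → List (Subset n)
subsets zero    = [] ∷ []
subsets (suc n) = map (outside ∷_) (subsets n) ++ map (inside ∷_) (subsets n)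

∈-subsets : ∀ {n} (p : Subset n) → p ∈ₗ subsets n
∈-subsets []            = here refl
∈-subsets (outside ∷ p) = ∈-++⁺ˡ (∈-map⁺ (outside ∷_) (∈-subsets p))
∈-subsets (inside  ∷ p) = ∈-++⁺ʳ _ (∈-map⁺ (inside ∷_) (∈-subsets p))

_≟ₛ_ : ∀ {n} (p q : Subset n) → Dec (p ≡ q)
_≟ₛ_ = ≡-dec Bool._≟_

∑-subsets-suc : ∀ {n} (f : Subset (suc n) → ℕ) →
  ∑ (subsets (suc n)) f ≡ ∑ (subsets n) (f ∘ (outside ∷_)) + ∑ (subsets n) (f ∘ (inside ∷_))
∑-subsets-suc {n} f = trans (∑-++ (map (outside ∷_) (subsets n)) _ f)
  (cong₂ _+_ (∑-map _ (subsets n) f) (∑-map _ (subsets n) f))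

#-singleton : ∀ {n} (q : Subset n) → # (subsets n) (q ≟ₛ_) ≡ 1
#-singleton []            = refl
#-singleton (outside ∷ q) = trans (∑-subsets-suc (λ p → ind ((outside ∷ q) ≟ₛ p)))
  (cong₂ _+_ (trans (#-cong (subsets _) (λ p → (outside ∷ q) ≟ₛ (outside ∷ p)) (q ≟ₛ_) (λ { _ refl → refl }) (λ { _ refl → refl })) (#-singleton q))
             (#-empty (subsets _) (λ p → (outside ∷ q) ≟ₛ (inside ∷ p)) (λ _ ())))
#-singleton (inside ∷ q)  = trans (∑-subsets-suc (λ p → ind ((inside ∷ q) ≟ₛ p)))
  (cong₂ _+_ (#-empty (subsets _) (λ p → (inside ∷ q) ≟ₛ (outside ∷ p)) (λ _ ()))
             (trans (#-cong (subsets _) (λ p → (inside ∷ q) ≟ₛ (inside ∷ p)) (q ≟ₛ_) (λ { _ refl → refl }) (λ { _ refl → refl })) (#-singleton q)))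

#-unique : ∀ {n} {P : Subset n → Set} (P? : Decidable P) → (∀ p q → P p → P q → p ≡ q) → # (subsets n) P? ≤ 1
#-unique {n} P? unique with #-witness (subsets n) P?
... | inj₁ e       = ≤-trans (≤-reflexive e) z≤n
... | inj₂ (q , a) = ≤-trans (#-mono (subsets n) P? (q ≟ₛ_) (λ p → unique q p a)) (≤-reflexive (#-singleton q))

#-injection : ∀ {n} {P Q : Subset n → Set} (P? : Decidable P) (Q? : Decidable Q) (g : Subset n → Subset n) →
  (∀ p → P p → Q (g p)) → (∀ p q → P p → P q → g p ≡ g q → p ≡ q) → # (subsets n) P? ≤ # (subsets n) Q?
#-injection {n} P? Q? g maps injective = subst₂ _≤_ (*-identityʳ _) (*-identityʳ _)
  (double-count (subsets n) (subsets n) P? Q? (λ p q → ind (P? p ×-dec (g p ≟ₛ q))) 1 1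
    (λ p a → #-positive (λ q → P? p ×-dec (g p ≟ₛ q)) (∈-subsets (g p)) (a , refl))
    upper)
  where
  upper : ∀ q → # (subsets n) (λ p → P? p ×-dec (g p ≟ₛ q)) ≤ ind (Q? q) * 1
  upper q with Q? q
  ... | yes _ = #-unique (λ p → P? p ×-dec (g p ≟ₛ q)) (λ p p′ (a , e) (a′ , e′) → injective p p′ a a′ (trans e (sym e′)))
  ... | no ¬b = ≤-reflexive (#-empty (subsets n) (λ p → P? p ×-dec (g p ≟ₛ q)) (λ { p (a , refl) → ¬b (maps p a) }))

zero∉ : ∀ {n} {p : Subset n} → ¬ (zero ∈ (outside ∷ p))
zero∉ ()

#-subsets-⊆ : ∀ {n} (E : Subset n) → # (subsets n) (_⊆? E) ≡ 2 ^ ∣ E ∣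
#-subsets-⊆ []            = refl
#-subsets-⊆ (outside ∷ E) = trans (∑-subsets-suc (λ B → ind (B ⊆? (outside ∷ E)))) (trans (cong₂ _+_
  (trans (#-cong (subsets _) (λ B → (outside ∷ B) ⊆? (outside ∷ E)) (_⊆? E) (λ _ → drop-∷-⊆) (λ _ → s⊆s)) (#-subsets-⊆ E))
  (#-empty (subsets _) (λ B → (inside ∷ B) ⊆? (outside ∷ E)) (λ B B⊆E → zero∉ (B⊆E here)))) (+-identityʳ _))
#-subsets-⊆ (inside ∷ E)  = trans (∑-subsets-suc (λ B → ind (B ⊆? (inside ∷ E)))) (cong₂ _+_
  (trans (#-cong (subsets _) (λ B → (outside ∷ B) ⊆? (inside ∷ E)) (_⊆? E) (λ _ → drop-∷-⊆) (λ _ → out⊆)) (#-subsets-⊆ E))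
  (trans (#-cong (subsets _) (λ B → (inside ∷ B) ⊆? (inside ∷ E)) (_⊆? E) (λ _ → drop-∷-⊆) (λ _ → s⊆s))
    (trans (#-subsets-⊆ E) (sym (+-identityʳ _)))))

Between : ∀ {n} (A Z : Subset n) → ℕ → Subset n → Set
Between A Z m E = A ⊆ E × E ⊆ ∁ Z × ∣ E ∣ ≡ m

between? : ∀ {n} (A Z : Subset n) (m : ℕ) → Decidable (Between A Z m)
between? A Z m E = (A ⊆? E) ×-dec ((E ⊆? ∁ Z) ×-dec (∣ E ∣ ≟ m))

-- The sets counted arise from `A` by choosing `j` of the `r` points outside `A` and `Z`. The
-- recursion follows the first point; when that point is free, Pascal's rule combines the two cases.
#-between : ∀ {n} (A Z : Subset n) j r → A ⊆ ∁ Z → ∣ A ∣ + ∣ Z ∣ + r ≡ n →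
  # (subsets n) (between? A Z (∣ A ∣ + j)) ≡ r C j
#-between [] [] zero    zero _ refl = refl
#-between [] [] (suc j) zero _ refl = refl
#-between (inside ∷ A) (inside ∷ Z) j r A⊆∁Z _ = contradiction (A⊆∁Z here) zero∉
#-between {suc n} (inside ∷ A) (outside ∷ Z) j r A⊆∁Z size =
  trans (∑-subsets-suc (λ E → ind (between? (inside ∷ A) (outside ∷ Z) (suc ∣ A ∣ + j) E))) (cong₂ _+_
    (#-empty (subsets n) (between? (inside ∷ A) (outside ∷ Z) (suc ∣ A ∣ + j) ∘ (outside ∷_)) (λ E (A⊆E , _) → zero∉ (A⊆E here)))
    (trans (#-cong (subsets n) (between? (inside ∷ A) (outside ∷ Z) (suc ∣ A ∣ + j) ∘ (inside ∷_)) (between? A Z (∣ A ∣ + j))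
      (λ E (A⊆E , E⊆ , e) → drop-∷-⊆ A⊆E , drop-∷-⊆ E⊆ , suc-injective e)
      (λ E (A⊆E , E⊆ , e) → s⊆s A⊆E , s⊆s E⊆ , cong suc e))
    (#-between A Z j r (drop-∷-⊆ A⊆∁Z) (suc-injective size))))
#-between {suc n} (outside ∷ A) (inside ∷ Z) j r A⊆∁Z size =
  trans (∑-subsets-suc (λ E → ind (between? (outside ∷ A) (inside ∷ Z) (∣ A ∣ + j) E))) (trans (cong₂ _+_
    (trans (#-cong (subsets n) (between? (outside ∷ A) (inside ∷ Z) (∣ A ∣ + j) ∘ (outside ∷_)) (between? A Z (∣ A ∣ + j))
      (λ E (A⊆E , E⊆ , e) → drop-∷-⊆ A⊆E , drop-∷-⊆ E⊆ , e)
      (λ E (A⊆E , E⊆ , e) → s⊆s A⊆E , s⊆s E⊆ , e))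
    (#-between A Z j r (drop-∷-⊆ A⊆∁Z) (suc-injective (trans (cong (_+ r) (sym (+-suc ∣ A ∣ ∣ Z ∣))) size))))
    (#-empty (subsets n) (between? (outside ∷ A) (inside ∷ Z) (∣ A ∣ + j) ∘ (inside ∷_)) (λ E (_ , E⊆ , _) → zero∉ (E⊆ here))))
    (+-identityʳ _))
-- No free point may remain, yet the first one is free: the disjoint tails `A` and `Z` have at most
-- `n` points in all, while `size` asks for n + 1.
#-between {suc n} (outside ∷ A) (outside ∷ Z) j zero A⊆∁Z size =
  contradiction (≤-trans (≤-reflexive (trans (sym size) (+-identityʳ _))) small) 1+n≰n
  where
  small : ∣ A ∣ + ∣ Z ∣ ≤ n
  small = ≤-trans (+-monoˡ-≤ ∣ Z ∣ (p⊆q⇒∣p∣≤∣q∣ (drop-∷-⊆ A⊆∁Z)))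
    (≤-reflexive (trans (cong (_+ ∣ Z ∣) (∣∁p∣≡n∸∣p∣ Z)) (m∸n+n≡m (∣p∣≤n Z))))
#-between {suc n} (outside ∷ A) (outside ∷ Z) j (suc r) A⊆∁Z size =
  trans (∑-subsets-suc (λ E → ind (between? (outside ∷ A) (outside ∷ Z) (∣ A ∣ + j) E))) (trans (cong₂ _+_
    (trans (#-cong (subsets n) (between? (outside ∷ A) (outside ∷ Z) (∣ A ∣ + j) ∘ (outside ∷_)) (between? A Z (∣ A ∣ + j))
      (λ E (A⊆E , E⊆ , e) → drop-∷-⊆ A⊆E , drop-∷-⊆ E⊆ , e)
      (λ E (A⊆E , E⊆ , e) → s⊆s A⊆E , out⊆ E⊆ , e))
    (#-between A Z j r (drop-∷-⊆ A⊆∁Z) size′))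
    (with-zero j))
    (pascal j))
  where
  size′ : ∣ A ∣ + ∣ Z ∣ + r ≡ n
  size′ = suc-injective (trans (sym (+-suc (∣ A ∣ + ∣ Z ∣) r)) size)
  tails : ℕ → ℕ
  tails zero    = 0
  tails (suc j) = r C j
  pascal : ∀ j → r C j + tails j ≡ suc r C j
  pascal zero    = refl
  pascal (suc j) = trans (+-comm (r C suc j) _) (nCk+nC[k+1]≡[n+1]C[k+1] r j)
  with-zero : ∀ j → # (subsets n) (between? (outside ∷ A) (outside ∷ Z) (∣ A ∣ + j) ∘ (inside ∷_)) ≡ tails j
  with-zero zero    = #-empty (subsets n) (between? (outside ∷ A) (outside ∷ Z) (∣ A ∣ + 0) ∘ (inside ∷_))
    (λ E (A⊆E , _ , e) → 1+n≰n (≤-trans (≤-reflexive (trans e (+-identityʳ _))) (p⊆q⇒∣p∣≤∣q∣ (drop-∷-⊆ A⊆E))))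
  with-zero (suc j) = trans (#-cong (subsets n) (between? (outside ∷ A) (outside ∷ Z) (∣ A ∣ + suc j) ∘ (inside ∷_)) (between? A Z (∣ A ∣ + j))
      (λ E (A⊆E , E⊆ , e) → drop-∷-⊆ A⊆E , drop-∷-⊆ E⊆ , suc-injective (trans e (+-suc ∣ A ∣ j)))
      (λ E (A⊆E , E⊆ , e) → out⊆ A⊆E , s⊆s E⊆ , trans (cong suc e) (sym (+-suc ∣ A ∣ j))))
    (#-between A Z j r (drop-∷-⊆ A⊆∁Z) size′)

#-containing : ∀ {n} (A : Subset n) j → # (subsets n) (λ E → (A ⊆? E) ×-dec (∣ E ∣ ≟ ∣ A ∣ + j)) ≤ n ^ j
#-containing {n} A j = begin
  # (subsets n) (λ E → (A ⊆? E) ×-dec (∣ E ∣ ≟ ∣ A ∣ + j))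
    ≤⟨ #-mono (subsets n) (λ E → (A ⊆? E) ×-dec (∣ E ∣ ≟ ∣ A ∣ + j)) (between? A ⊥ (∣ A ∣ + j))
         (λ E (A⊆E , e) → A⊆E , (λ _ → x∉p⇒x∈∁p ∉⊥) , e) ⟩
  # (subsets n) (between? A ⊥ (∣ A ∣ + j))
    ≡⟨ #-between A ⊥ j (n ∸ ∣ A ∣) (λ _ → x∉p⇒x∈∁p ∉⊥)
         (trans (cong (λ z → ∣ A ∣ + z + (n ∸ ∣ A ∣)) (∣⊥∣≡0 n)) (trans (cong (_+ (n ∸ ∣ A ∣)) (+-identityʳ _)) (m+[n∸m]≡n (∣p∣≤n A)))) ⟩
  (n ∸ ∣ A ∣) C j     ≤⟨ nCk≤n^k _ j ⟩
  (n ∸ ∣ A ∣) ^ j     ≤⟨ ^-monoˡ-≤ j (m∸n≤m n ∣ A ∣) ⟩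
  n ^ j               ∎
  where open ≤-Reasoning

#-size : ∀ n k → # (subsets n) (λ E → ∣ E ∣ ≟ k) ≤ n C k
#-size n k = begin
  # (subsets n) (λ E → ∣ E ∣ ≟ k)
    ≤⟨ #-mono (subsets n) (λ E → ∣ E ∣ ≟ k) (between? ⊥ ⊥ (∣ ⊥ {n} ∣ + k))
         (λ E e → ⊥⊆ , (λ _ → x∉p⇒x∈∁p ∉⊥) , trans e (cong (_+ k) (sym (∣⊥∣≡0 n)))) ⟩
  # (subsets n) (between? ⊥ ⊥ (∣ ⊥ {n} ∣ + k))
    ≡⟨ #-between ⊥ ⊥ k n ⊥⊆ (cong₂ (λ y z → y + z + n) (∣⊥∣≡0 n) (∣⊥∣≡0 n)) ⟩
  n C k ∎
  where open ≤-Reasoning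

#-size-avoiding : ∀ {n} (x : Fin (suc n)) k → # (subsets (suc n)) (λ E → ¬? (x ∈? E) ×-dec (∣ E ∣ ≟ k)) ≤ n C k
#-size-avoiding {n} x k = begin
  # (subsets (suc n)) (λ E → ¬? (x ∈? E) ×-dec (∣ E ∣ ≟ k))
    ≤⟨ #-mono (subsets (suc n)) (λ E → ¬? (x ∈? E) ×-dec (∣ E ∣ ≟ k)) (between? ⊥ ⁅ x ⁆ (∣ ⊥ {suc n} ∣ + k))
         (λ E (x∉E , e) → ⊥⊆ , (λ {y} y∈E → x∉p⇒x∈∁p (λ y∈x → x∉E (subst (_∈ E) (x∈⁅y⁆⇒x≡y x y∈x) y∈E))) ,
                          trans e (cong (_+ k) (sym (∣⊥∣≡0 (suc n))))) ⟩
  # (subsets (suc n)) (between? ⊥ ⁅ x ⁆ (∣ ⊥ {suc n} ∣ + k))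
    ≡⟨ #-between ⊥ ⁅ x ⁆ k n ⊥⊆ (cong₂ (λ y z → y + z + n) (∣⊥∣≡0 (suc n)) (∣⁅x⁆∣≡1 x)) ⟩
  n C k ∎
  where open ≤-Reasoning

-- Cardinalities of unions and one-point changes

∣p∪q∣≤∣p∣+∣q∣ : ∀ {n} (p q : Subset n) → ∣ p ∪ q ∣ ≤ ∣ p ∣ + ∣ q ∣
∣p∪q∣≤∣p∣+∣q∣ []            []            = z≤n
∣p∪q∣≤∣p∣+∣q∣ (outside ∷ p) (outside ∷ q) = ∣p∪q∣≤∣p∣+∣q∣ p q
∣p∪q∣≤∣p∣+∣q∣ (outside ∷ p) (inside  ∷ q) = ≤-trans (s≤s (∣p∪q∣≤∣p∣+∣q∣ p q)) (≤-reflexive (sym (+-suc ∣ p ∣ ∣ q ∣)))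
∣p∪q∣≤∣p∣+∣q∣ (inside  ∷ p) (outside ∷ q) = s≤s (∣p∪q∣≤∣p∣+∣q∣ p q)
∣p∪q∣≤∣p∣+∣q∣ (inside  ∷ p) (inside  ∷ q) = s≤s (≤-trans (∣p∪q∣≤∣p∣+∣q∣ p q) (+-monoʳ-≤ ∣ p ∣ (n≤1+n ∣ q ∣)))

∣p∪q∣≡∣p∣+∣q∣ : ∀ {n} (p q : Subset n) → p ⊆ ∁ q → ∣ p ∪ q ∣ ≡ ∣ p ∣ + ∣ q ∣
∣p∪q∣≡∣p∣+∣q∣ []            []            _ = refl
∣p∪q∣≡∣p∣+∣q∣ (outside ∷ p) (outside ∷ q) d = ∣p∪q∣≡∣p∣+∣q∣ p q (drop-∷-⊆ d)
∣p∪q∣≡∣p∣+∣q∣ (outside ∷ p) (inside  ∷ q) d = trans (cong suc (∣p∪q∣≡∣p∣+∣q∣ p q (drop-∷-⊆ d))) (sym (+-suc ∣ p ∣ ∣ q ∣))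
∣p∪q∣≡∣p∣+∣q∣ (inside  ∷ p) (outside ∷ q) d = cong suc (∣p∪q∣≡∣p∣+∣q∣ p q (drop-∷-⊆ d))
∣p∪q∣≡∣p∣+∣q∣ (inside  ∷ p) (inside  ∷ q) d = contradiction (d here) zero∉

∣p∪⁅x⁆∣≡1+∣p∣ : ∀ {n} {p : Subset n} {x} → x ∉ p → ∣ p ∪ ⁅ x ⁆ ∣ ≡ suc ∣ p ∣
∣p∪⁅x⁆∣≡1+∣p∣ {p = p} {x} x∉p = trans (∣p∪q∣≡∣p∣+∣q∣ p ⁅ x ⁆ (λ {y} y∈p → x∉p⇒x∈∁p (λ y∈x → x∉p (subst (_∈ p) (x∈⁅y⁆⇒x≡y x y∈x) y∈p))))
  (trans (cong (∣ p ∣ +_) (∣⁅x⁆∣≡1 x)) (+-comm ∣ p ∣ 1))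

⊆∧∣∣≡⇒≡ : ∀ {n} {p q : Subset n} → p ⊆ q → ∣ p ∣ ≡ ∣ q ∣ → p ≡ q
⊆∧∣∣≡⇒≡ {p = p} {q} p⊆q e with q ⊆? p
... | yes q⊆p = ⊆-antisym p⊆q q⊆p
... | no  q⊈p = contradiction e (<⇒≢ (p⊂q⇒∣p∣<∣q∣ (p⊆q , missing)))
  where
  missing : ∃ λ x → x ∈ q × x ∉ p
  missing with Data.Fin.Properties.any? (λ x → (x ∈? q) ×-dec ¬? (x ∈? p))
  ... | yes w = w
  ... | no ¬w = contradiction (λ {x} x∈q → decidable-stable (x ∈? p) (λ x∉p → ¬w (x , x∈q , x∉p))) q⊈p

x∉p-x : ∀ {n} (p : Subset n) x → x ∉ p - x
x∉p-x (s ∷ p) zero    ()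
x∉p-x (s ∷ p) (suc x) x∈ = x∉p-x p x (drop-there x∈)

∈-─⇒∉ : ∀ {n} (p q : Subset n) {x} → x ∈ p ─ q → x ∉ q
∈-─⇒∉ (s ∷ p) (inside  ∷ q) ()         here
∈-─⇒∉ (s ∷ p) (t       ∷ q) (there x∈) (there x∈q) = ∈-─⇒∉ p q x∈ x∈q

∪-⊆ : ∀ {n} {p q r : Subset n} → p ⊆ r → q ⊆ r → p ∪ q ⊆ r
∪-⊆ {p = p} {q} p⊆r q⊆r x∈ with x∈p∪q⁻ p q x∈
... | inj₁ x∈p = p⊆r x∈p
... | inj₂ x∈q = q⊆r x∈q

⁅⁆-⊆ : ∀ {n x} {p : Subset n} → x ∈ p → ⁅ x ⁆ ⊆ p
⁅⁆-⊆ {x = x} {p} x∈p y∈ = subst (_∈ p) (sym (x∈⁅y⁆⇒x≡y x y∈)) x∈p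

p-x∪x≡p : ∀ {n} {p : Subset n} {x} → x ∈ p → (p - x) ∪ ⁅ x ⁆ ≡ p
p-x∪x≡p {p = p} {x} x∈p = ⊆-antisym (∪-⊆ (p─q⊆p p ⁅ x ⁆) (⁅⁆-⊆ x∈p)) back
  where
  back : p ⊆ (p - x) ∪ ⁅ x ⁆
  back {y} y∈p with y Fin.≟ x
  ... | yes refl = x∈p∪q⁺ (inj₂ (x∈⁅x⁆ x))
  ... | no y≢x   = x∈p∪q⁺ (inj₁ (x∈p∧x≢y⇒x∈p-y y∈p y≢x))

1+∣p-x∣≡∣p∣ : ∀ {n} {p : Subset n} {x} → x ∈ p → suc ∣ p - x ∣ ≡ ∣ p ∣
1+∣p-x∣≡∣p∣ {p = p} {x} x∈p = trans (sym (∣p∪⁅x⁆∣≡1+∣p∣ (x∉p-x p x))) (cong ∣_∣ (p-x∪x≡p x∈p))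

#-allFin-∈ : ∀ {n} (p : Subset n) → # (allFin n) (_∈? p) ≡ ∣ p ∣
#-allFin-∈ []      = refl
#-allFin-∈ {suc n} (s ∷ p) = begin
  ind (zero ∈? (s ∷ p)) + ∑ (Data.List.tabulate Fin.suc) (λ x → ind (x ∈? (s ∷ p)))
    ≡⟨ cong (λ xs → ind (zero ∈? (s ∷ p)) + ∑ xs (λ x → ind (x ∈? (s ∷ p)))) (sym (map-tabulate (λ x → x) Fin.suc)) ⟩
  ind (zero ∈? (s ∷ p)) + ∑ (map Fin.suc (allFin n)) (λ x → ind (x ∈? (s ∷ p)))
    ≡⟨ cong (ind (zero ∈? (s ∷ p)) +_) (trans (∑-map Fin.suc (allFin n) _)
         (trans (#-cong (allFin n) (λ x → suc x ∈? (s ∷ p)) (_∈? p) (λ _ → drop-there) (λ _ → there)) (#-allFin-∈ p))) ⟩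
  ind (zero ∈? (s ∷ p)) + ∣ p ∣
    ≡⟨ first s ⟩
  ∣ s ∷ p ∣ ∎
  where
  open ≡-Reasoning
  first : ∀ s → ind (zero ∈? (s ∷ p)) + ∣ p ∣ ≡ ∣ s ∷ p ∣
  first outside = refl
  first inside  = refl

_∈ₗ?_ : ∀ {n} (F : Subset n) (ms : List (Subset n)) → Dec (F ∈ₗ ms)
_∈ₗ?_ = DecMembership._∈?_ _≟ₛ_

length≤#-∈ : ∀ {n} {ms : List (Subset n)} → Unique ms → length ms ≤ # (subsets n) (_∈ₗ? ms)
length≤#-∈ {ms = []} _ = z≤n
length≤#-∈ {n} {ms = F ∷ ms} (F∉ ∷ unique) = begin
  1 + length ms                                        ≤⟨ +-monoʳ-≤ 1 (length≤#-∈ unique) ⟩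
  1 + # (subsets n) (_∈ₗ? ms)                           ≡⟨ cong (_+ # (subsets n) (_∈ₗ? ms)) (sym (#-singleton F)) ⟩
  # (subsets n) (F ≟ₛ_) + # (subsets n) (_∈ₗ? ms)       ≤⟨ #-disjoint (subsets n) (_∈ₗ? (F ∷ ms)) (F ≟ₛ_) (_∈ₗ? ms)
                                                            (λ G F≡G → here (sym F≡G)) (λ _ → there)
                                                            (λ { G refl G∈ → lookup F∉ G∈ refl }) ⟩
  # (subsets n) (_∈ₗ? (F ∷ ms))                         ∎
  where
  open ≤-Reasoning

-- Double counting of triples (B, D, E) with B ∪ D ⊆ E and E in `S`. Each pair extends by `m` points
-- off `Z` in at least n^m / Γ m ways. Conversely E has 2^(a+m) subsets, hence contains at most the
-- square of that many pairs. The set `Z` may depend on the pair.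
pair-count : ∀ {n} {P S : Subset n → Set} {Q : Subset n → Subset n → Set}
  (P? : Decidable P) (Q? : ∀ B → Decidable (Q B)) (S? : Decidable S) (a m w : ℕ) →
  (∀ B → P B → w ≤ # (subsets n) (Q? B)) →
  (∀ B D → P B → Q B D → ∃ λ Z → B ∪ D ⊆ ∁ Z × ∣ B ∪ D ∣ ≡ a × 2 * (m + (a + ∣ Z ∣)) ≤ n ×
                                (∀ E → Between (B ∪ D) Z (a + m) E → S E)) →
  (∀ E → S E → ∣ E ∣ ≡ a + m) →
  # (subsets n) P? * (w * n ^ m) ≤ # (subsets n) S? * (2 ^ (a + m) * 2 ^ (a + m) * Γ m)
pair-count {n} {P} {S} {Q} P? Q? S? a m w many extend size =
  double-count 𝓢 𝓢 P? S? (λ B E → ∑ 𝓢 (λ D → ind (R? B D E) * Γ m)) _ _ lower upper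
  where
  open ≤-Reasoning
  𝓢 = subsets n
  R? : ∀ B D E → Dec (P B × Q B D × B ∪ D ⊆ E × S E)
  R? B D E = P? B ×-dec (Q? B D ×-dec ((B ∪ D ⊆? E) ×-dec S? E))
  extensions : ∀ B D → P B → Q B D → n ^ m ≤ ∑ 𝓢 (λ E → ind (R? B D E) * Γ m)
  extensions B D b c with extend B D b c
  ... | Z , disjoint , refl , large , inS = begin
    n ^ m                                            ≤⟨ n^k≤Γ*rCk n r m bound ⟩
    Γ m * (r C m)                                    ≡⟨ cong (Γ m *_) (sym (#-between (B ∪ D) Z m r disjoint (m+[n∸m]≡n AZ≤n))) ⟩
    Γ m * # 𝓢 (between? (B ∪ D) Z (∣ B ∪ D ∣ + m))   ≤⟨ *-monoʳ-≤ (Γ m) (#-mono 𝓢 (between? (B ∪ D) Z (∣ B ∪ D ∣ + m)) (R? B D)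
                                                          (λ E E∈ → b , c , proj₁ E∈ , inS E E∈)) ⟩
    Γ m * # 𝓢 (R? B D)                               ≡⟨ *-comm (Γ m) _ ⟩
    # 𝓢 (R? B D) * Γ m                               ≡⟨ sym (∑-*ʳ 𝓢 _ (Γ m)) ⟩
    ∑ 𝓢 (λ E → ind (R? B D E) * Γ m)                 ∎
    where
    t = ∣ B ∪ D ∣ + ∣ Z ∣
    r = n ∸ t
    arrange : ∀ m t → 2 * (m + t) ≡ (m + m) + (t + t)
    arrange = solve-∀
    large′ : (m + m) + (t + t) ≤ n
    large′ = ≤-trans (≤-reflexive (sym (arrange m t))) large
    AZ≤n : t ≤ n
    AZ≤n = ≤-trans (m≤m+n t t) (≤-trans (m≤n+m (t + t) (m + m)) large′)
    arrange′ : ∀ r t → (r + t) + (r + t) ≡ (r + r) + (t + t)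
    arrange′ = solve-∀
    arrange″ : ∀ m n t → (m + m) + n + (t + t) ≡ (m + m) + (t + t) + n
    arrange″ = solve-∀
    bound : m + m + n ≤ r + r
    -- With r = n - t, the condition 2m + 2t ≤ n gives n + 2m ≤ 2r.
    bound = +-cancelʳ-≤ (t + t) (m + m + n) (r + r) (begin
      m + m + n + (t + t)   ≡⟨ arrange″ m n t ⟩
      m + m + (t + t) + n   ≤⟨ +-monoˡ-≤ n large′ ⟩
      n + n                 ≡⟨ cong (λ z → z + z) (sym (m∸n+n≡m AZ≤n)) ⟩
      (r + t) + (r + t)     ≡⟨ arrange′ r t ⟩
      r + r + (t + t)       ∎)
  lower : ∀ B → P B → w * n ^ m ≤ ∑ 𝓢 (λ E → ∑ 𝓢 (λ D → ind (R? B D E) * Γ m))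
  lower B b = begin
    w * n ^ m                                        ≤⟨ *-monoˡ-≤ (n ^ m) (many B b) ⟩
    # 𝓢 (Q? B) * n ^ m                               ≤⟨ #-*-≤-∑ 𝓢 (Q? B) _ (n ^ m) (λ D → extensions B D b) ⟩
    ∑ 𝓢 (λ D → ∑ 𝓢 (λ E → ind (R? B D E) * Γ m))     ≡⟨ ∑-swap 𝓢 𝓢 _ ⟩
    ∑ 𝓢 (λ E → ∑ 𝓢 (λ D → ind (R? B D E) * Γ m))     ∎
  upper : ∀ E → ∑ 𝓢 (λ B → ∑ 𝓢 (λ D → ind (R? B D E) * Γ m)) ≤ ind (S? E) * (2 ^ (a + m) * 2 ^ (a + m) * Γ m)
  upper E with S? E
  ... | no ¬e = ≤-trans (∑-mono 𝓢 (λ B → ≤-trans (∑-mono 𝓢 (λ D → ≤-reflexive (cong (_* Γ m)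
                  (ind-no (P? B ×-dec (Q? B D ×-dec ((B ∪ D ⊆? E) ×-dec no ¬e))) (¬e ∘ proj₂ ∘ proj₂ ∘ proj₂)))))
                  (≤-reflexive (∑-zero 𝓢)))) (≤-reflexive (∑-zero 𝓢))
  ... | yes e = begin
    ∑ 𝓢 (λ B → ∑ 𝓢 (λ D → ind (P? B ×-dec (Q? B D ×-dec ((B ∪ D ⊆? E) ×-dec yes e))) * Γ m))
      ≤⟨ ∑-mono 𝓢 (λ B → ∑-mono 𝓢 (λ D → *-monoˡ-≤ (Γ m) (ind-≤ (P? B ×-dec (Q? B D ×-dec ((B ∪ D ⊆? E) ×-dec yes e)))
           (λ (_ , _ , BD⊆E , _) → both B D BD⊆E)))) ⟩
    ∑ 𝓢 (λ B → ∑ 𝓢 (λ D → ind (B ⊆? E) * ind (D ⊆? E) * Γ m))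
      ≡⟨ ∑-cong 𝓢 (λ B → trans (∑-*ʳ 𝓢 _ (Γ m)) (cong (_* Γ m) (∑-*ˡ 𝓢 _ (ind (B ⊆? E))))) ⟩
    ∑ 𝓢 (λ B → ind (B ⊆? E) * # 𝓢 (_⊆? E) * Γ m)
      ≡⟨ trans (∑-*ʳ 𝓢 _ (Γ m)) (cong (_* Γ m) (∑-*ʳ 𝓢 _ (# 𝓢 (_⊆? E)))) ⟩
    # 𝓢 (_⊆? E) * # 𝓢 (_⊆? E) * Γ m
      ≡⟨ cong (λ z → z * z * Γ m) (trans (#-subsets-⊆ E) (cong (2 ^_) (size E e))) ⟩
    2 ^ (a + m) * 2 ^ (a + m) * Γ m
      ≡⟨ sym (+-identityʳ _) ⟩
    1 * (2 ^ (a + m) * 2 ^ (a + m) * Γ m) ∎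
    where
    both : ∀ B D → B ∪ D ⊆ E → 1 ≤ ind (B ⊆? E) * ind (D ⊆? E)
    both B D BD⊆E rewrite ind-yes (B ⊆? E) (λ {_} → BD⊆E ∘ p⊆p∪q D) | ind-yes (D ⊆? E) (λ {_} → BD⊆E ∘ q⊆p∪q B D) = ≤-refl

-- Witnesses and the points they force

module WitnessFamily {n d s : ℕ} (𝓕 : UniformFamily n (suc d)) (witness : IsWitnessFamily s 𝓕) where

  _∈𝓕 : Subset n → Set
  F ∈𝓕 = F ∈ₗ members 𝓕

  _∈𝓕? : ∀ F → Dec (F ∈𝓕)
  F ∈𝓕? = F ∈ₗ? members 𝓕

  -- The chosen witness of a member of 𝓕 (junk value ⊥ elsewhere).
  β : Subset n → Subset n
  β F with F ∈𝓕?
  ... | yes F∈ = proj₁ (witness F F∈)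
  ... | no _   = ⊥

  β-spec : ∀ {F} → F ∈𝓕 → β F ⊆ F × ∣ β F ∣ ≡ s × (∀ F′ → F′ ∈𝓕 → F ∩ F′ ≢ β F)
  β-spec {F} F∈ with F ∈𝓕?
  ... | yes F∈′ = proj₂ (witness F F∈′)
  ... | no F∉   = contradiction F∈ F∉

  β-⊆ : ∀ {F} → F ∈𝓕 → β F ⊆ F
  β-⊆ = proj₁ ∘ β-spec

  β-size : ∀ {F} → F ∈𝓕 → ∣ β F ∣ ≡ s
  β-size = proj₁ ∘ proj₂ ∘ β-spec

  -- `F ∩ F′` contains `β F` and differs from it, so it has a further point.
  meets-outside : ∀ {F F′} → F ∈𝓕 → F′ ∈𝓕 → β F ⊆ F′ → ∃ λ y → y ∈ F × y ∈ F′ × y ∉ β F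
  meets-outside {F} {F′} F∈ F′∈ β⊆F′ with any? (λ y → (y ∈? F) ×-dec ((y ∈? F′) ×-dec ¬? (y ∈? β F)))
  ... | yes w = w
  ... | no ¬w = contradiction (⊆-antisym inside-β (λ y∈ → x∈p∩q⁺ (β-⊆ F∈ y∈ , β⊆F′ y∈))) (proj₂ (proj₂ (β-spec F∈)) F′ F′∈)
    where
    inside-β : F ∩ F′ ⊆ β F
    inside-β {y} y∈ = let (y∈F , y∈F′) = x∈p∩q⁻ F F′ y∈ in
      decidable-stable (y ∈? β F) (λ y∉β → ¬w (y , y∈F , y∈F′ , y∉β))

  -- A set `B` contained in no member forces every point outside `B`, vacuously.
  Forces : Subset n → Fin n → Set
  Forces B y = y ∉ B × (∀ F → F ∈𝓕 → B ⊆ F → y ∈ F)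

  escape? : ∀ B y → Dec (∃ λ F → F ∈𝓕 × B ⊆ F × y ∉ F)
  escape? B y = anySubset? (λ F → (F ∈𝓕?) ×-dec ((B ⊆? F) ×-dec ¬? (y ∈? F)))

  forces? : ∀ B y → Dec (Forces B y)
  forces? B y with y ∈? B | escape? B y
  ... | yes y∈B | _                     = no (λ (y∉B , _) → y∉B y∈B)
  ... | no _    | yes (F , F∈ , B⊆ , y∉) = no (λ (_ , f) → y∉ (f F F∈ B⊆))
  ... | no y∉B  | no ¬e                 = yes (y∉B , λ F F∈ B⊆F → decidable-stable (y ∈? F) (λ y∉F → ¬e (F , F∈ , B⊆F , y∉F)))

  escape : ∀ {B y} → y ∉ B → ¬ Forces B y → ∃ λ F → F ∈𝓕 × B ⊆ F × y ∉ F
  escape {B} {y} y∉B ¬f = decidable-stable (escape? B y) (λ ¬e →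
    ¬f (y∉B , λ F F∈ B⊆F → decidable-stable (y ∈? F) (λ y∉F → ¬e (F , F∈ , B⊆F , y∉F))))

  Captured : Subset n → Set
  Captured B = ∃ (Forces B)

  captured? : ∀ B → Dec (Captured B)
  captured? B = any? (forces? B)

  #-elements : ∀ {B F} → F ∈𝓕 → # (allFin n) (λ y → (y ∈? F) ×-dec ¬? (y ∈? B)) ≤ suc d
  #-elements {B} {F} F∈ = ≤-trans (#-mono (allFin n) (λ y → (y ∈? F) ×-dec ¬? (y ∈? B)) (_∈? F) (λ _ → proj₁))
    (≤-reflexive (trans (#-allFin-∈ F) (uniform 𝓕 F F∈)))

  -- If B forces nothing, every G with witness B contains B and two more
  -- elements: one from a fixed G₁, and one from a member of 𝓕 that contains B
  -- but not the first element.
  #-link : ∀ {B} j → ∣ B ∣ ≡ s → suc d ≡ suc (suc s) + j → ¬ Captured B →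
    # (subsets n) (λ G → (G ∈𝓕?) ×-dec (β G ≟ₛ B)) ≤ suc d * (suc d * n ^ j)
  #-link {B} j B-size k≡ ¬captured with #-witness (subsets n) (λ G → (G ∈𝓕?) ×-dec (β G ≟ₛ B))
  ... | inj₁ e = ≤-trans (≤-reflexive e) z≤n
  ... | inj₂ (G₁ , G₁∈ , refl) = ≤-trans
    (#-cover (subsets n) (allFin n) inLink? (λ y → (y ∈? G₁) ×-dec ¬? (y ∈? B)) (λ G y → y ∈? G) (suc d * n ^ j)
      (λ G (G∈ , e) → let (y , y∈G , y∈G₁ , y∉) = meets-outside G∈ G₁∈ (subst (_⊆ G₁) (sym e) (β-⊆ G₁∈)) in
        y , ∈-allFin y , (y∈G₁ , subst (y ∉_) e y∉) , y∈G)
      second)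
    (*-monoˡ-≤ (suc d * n ^ j) (#-elements G₁∈))
    where
    inLink? = λ G → (G ∈𝓕?) ×-dec (β G ≟ₛ B)
    second : ∀ y → y ∈ G₁ × y ∉ B → # (subsets n) (λ G → inLink? G ×-dec (y ∈? G)) ≤ suc d * n ^ j
    second y (y∈G₁ , y∉B) with escape y∉B (λ f → ¬captured (y , f))
    ... | F , F∈ , B⊆F , y∉F = ≤-trans
      (#-cover (subsets n) (allFin n) (λ G → inLink? G ×-dec (y ∈? G)) (λ z → (z ∈? F) ×-dec ¬? (z ∈? B)) (λ G z → z ∈? G) (n ^ j)
        (λ G ((G∈ , e) , _) → let (z , z∈G , z∈F , z∉) = meets-outside G∈ F∈ (subst (_⊆ F) (sym e) B⊆F) in
          z , ∈-allFin z , (z∈F , subst (z ∉_) e z∉) , z∈G)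
        third)
      (*-monoˡ-≤ (n ^ j) (#-elements F∈))
      where
      third : ∀ z → z ∈ F × z ∉ B → # (subsets n) (λ G → (inLink? G ×-dec (y ∈? G)) ×-dec (z ∈? G)) ≤ n ^ j
      third z (z∈F , z∉B) = ≤-trans
        (#-mono (subsets n) (λ G → (inLink? G ×-dec (y ∈? G)) ×-dec (z ∈? G)) (λ G → (Y ⊆? G) ×-dec (∣ G ∣ ≟ ∣ Y ∣ + j))
          (λ G (((G∈ , e) , y∈G) , z∈G) →
            ∪-⊆ (∪-⊆ (subst (_⊆ G) e (β-⊆ G∈)) (⁅⁆-⊆ y∈G)) (⁅⁆-⊆ z∈G) ,
            trans (uniform 𝓕 G G∈) (trans k≡ (cong (_+ j) (sym Y-size)))))
        (#-containing Y j)
        where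
        Y = (B ∪ ⁅ y ⁆) ∪ ⁅ z ⁆
        -- `F` contains `z` but not `y`, so the two points differ, `Y` has s + 2 elements, and only
        -- `j` elements of G remain free.
        z∉By : z ∉ B ∪ ⁅ y ⁆
        z∉By z∈ with x∈p∪q⁻ B ⁅ y ⁆ z∈
        ... | inj₁ z∈B = z∉B z∈B
        ... | inj₂ z∈y = y∉F (subst (_∈ F) (x∈⁅y⁆⇒x≡y y z∈y) z∈F)
        Y-size : ∣ Y ∣ ≡ suc (suc s)
        Y-size = trans (∣p∪⁅x⁆∣≡1+∣p∣ z∉By) (cong suc (trans (∣p∪⁅x⁆∣≡1+∣p∣ y∉B) (cong suc B-size)))

  Tight Loose : Subset n → Set
  Tight F = F ∈𝓕 × Captured (β F)
  Loose F = F ∈𝓕 × ¬ Captured (β F)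

  tight? : Decidable Tight
  tight? F = (F ∈𝓕?) ×-dec captured? (β F)

  loose? : Decidable Loose
  loose? F = (F ∈𝓕?) ×-dec ¬? (captured? (β F))

  -- For tight `F` this drops a point forced by `β F`; the value `F` in the other case is a default.
  own : Subset n → Subset n
  own F with captured? (β F)
  ... | yes (y , _) = F - y
  ... | no _        = F

  own-spec : ∀ {F} → Tight F → ∃ λ y → Forces (β F) y × y ∈ F × own F ≡ F - y
  own-spec {F} (F∈ , c) with captured? (β F)
  ... | yes (y , f@(_ , force)) = y , f , force F F∈ (β-⊆ F∈) , refl
  ... | no ¬c = contradiction c ¬c

  own-⊆ : ∀ {F} → Tight F → own F ⊆ F
  own-⊆ {F} t with own-spec t
  ... | y , _ , _ , e = subst (_⊆ F) (sym e) (p─q⊆p F ⁅ y ⁆)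

  own-size : ∀ {F} → Tight F → ∣ own F ∣ ≡ d
  own-size {F} t@(F∈ , _) with own-spec t
  ... | y , _ , y∈F , e = suc-injective (trans (cong (suc ∘ ∣_∣) e) (trans (1+∣p-x∣≡∣p∣ y∈F) (uniform 𝓕 F F∈)))

  β⊆own : ∀ {F} → Tight F → β F ⊆ own F
  β⊆own {F} t@(F∈ , _) with own-spec t
  ... | y , (y∉β , _) , _ , e = subst (β F ⊆_) (sym e)
    (λ x∈β → x∈p∧x≢y⇒x∈p-y (β-⊆ F∈ x∈β) (λ { refl → y∉β x∈β }))

  -- `own F` still contains `β F`, because a forced point lies outside the forcing set. So a member
  -- above `own F` also contains the dropped point, hence all of `F`, and the sizes agree.
  own-unique : ∀ {F F′} → Tight F → F′ ∈𝓕 → own F ⊆ F′ → F ≡ F′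
  own-unique {F} {F′} t@(F∈ , _) F′∈ own⊆F′ with own-spec t
  ... | y , (_ , force) , y∈F , e = ⊆∧∣∣≡⇒≡ F⊆F′ (trans (uniform 𝓕 F F∈) (sym (uniform 𝓕 F′ F′∈)))
    where
    F⊆F′ : F ⊆ F′
    F⊆F′ = subst (_⊆ F′) (trans (cong (_∪ ⁅ y ⁆) e) (p-x∪x≡p y∈F))
      (∪-⊆ own⊆F′ (⁅⁆-⊆ (force F′ F′∈ (λ x∈ → own⊆F′ (β⊆own t x∈)))))

  own-injective : ∀ F F′ → Tight F → Tight F′ → own F ≡ own F′ → F ≡ F′
  own-injective F F′ t t′ e = own-unique t (proj₁ t′) (subst (_⊆ F′) (sym e) (own-⊆ t′))

-- A point forced by many s-sets

#-through : ∀ {n} (z : Fin n) j → # (subsets n) (λ B → (z ∈? B) ×-dec (∣ B ∣ ≟ suc j)) ≤ n ^ j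
#-through {n} z j = ≤-trans
  (#-mono (subsets n) (λ B → (z ∈? B) ×-dec (∣ B ∣ ≟ suc j)) (λ B → (⁅ z ⁆ ⊆? B) ×-dec (∣ B ∣ ≟ ∣ ⁅ z ⁆ ∣ + j))
    (λ B (z∈B , e) → ⁅⁆-⊆ z∈B , trans e (cong (_+ j) (sym (∣⁅x⁆∣≡1 z)))))
  (#-containing ⁅ z ⁆ j)

-- Here n = N + 1, s = s′ + 1 and d = 2s + m, which builds in 2s ≤ d. The hypothesis `large` is the
-- room that `pair-count` asks for when `Z` has at most d + 2 points.
module LargeGround {N s′ m : ℕ}
  (𝓕 : UniformFamily (suc N) (suc (suc s′ + suc s′ + m))) (witness : IsWitnessFamily (suc s′) 𝓕)
  (large : 2 * (m + (suc s′ + suc s′ + suc (suc (suc s′ + suc s′ + m)))) ≤ suc N) where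

  private
    n s d k : ℕ
    n = suc N
    s = suc s′
    d = s + s + m
    k = suc d

  open WitnessFamily 𝓕 witness

  𝓢 = subsets n

  -- `T` bounds the loose members sharing a witness; its exponent is d - s - 1. `c` is the
  -- multiplicity in `pair-count` for a = 2s.
  T c : ℕ
  T = k * (k * n ^ (s′ + m))
  c = 2 ^ d * 2 ^ d * Γ m

  ∈∁ : ∀ {y} {p : Subset n} → y ∉ p → y ∈ ∁ p
  ∈∁ = x∉p⇒x∈∁p

  #-loose-link : ∀ B → ∣ B ∣ ≡ s → # 𝓢 (λ G → loose? G ×-dec (β G ≟ₛ B)) ≤ T
  #-loose-link B B-size with captured? B
  ... | yes cB = ≤-trans (≤-reflexive (#-empty 𝓢 (λ G → loose? G ×-dec (β G ≟ₛ B)) (λ { G ((_ , ¬c) , refl) → ¬c cB }))) z≤n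
  ... | no ¬cB = ≤-trans
    (#-mono 𝓢 (λ G → loose? G ×-dec (β G ≟ₛ B)) (λ G → (G ∈𝓕?) ×-dec (β G ≟ₛ B)) (λ G ((G∈ , _) , e) → G∈ , e))
    (#-link (s′ + m) B-size (trans (cong (λ z → 2 + (z + m)) (+-suc s′ s′)) (cong (3 +_) (+-assoc s′ s′ m))) ¬cB)

  forcedTo? : ∀ x B → Dec (∣ B ∣ ≡ s × Forces B x)
  forcedTo? x B = (∣ B ∣ ≟ s) ×-dec forces? B x

  starWeight : Fin n → ℕ
  starWeight x = # 𝓢 (forcedTo? x)

  -- In the constant of `heavy`, `k` pays for the forcing sets that meet a given member, `c` for the
  -- multiplicity in `pair-count`, and `suc (k * k)` exceeds the factor k² of `T` by one, which
  -- makes the final inequality strict.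
  module Concentrated (x : Fin n) (heavy : (k + c * suc (k * k)) * n ^ s′ ≤ starWeight x) where

    Off Missing HasStar : Subset n → Set
    Off H = H ∈𝓕 × x ∉ H
    Missing E = (x ∉ E × ∣ E ∣ ≡ d) × ¬ ((E ∪ ⁅ x ⁆) ∈𝓕)
    HasStar E = ∃ λ D → D ⊆ E × ∣ D ∣ ≡ s × Forces D x

    off? : Decidable Off
    off? H = (H ∈𝓕?) ×-dec ¬? (x ∈? H)

    avoiding? : ∀ E → Dec (x ∉ E × ∣ E ∣ ≡ d)
    avoiding? E = ¬? (x ∈? E) ×-dec (∣ E ∣ ≟ d)

    missing? : Decidable Missing
    missing? E = avoiding? E ×-dec ¬? ((E ∪ ⁅ x ⁆) ∈𝓕?)

    hasStar? : Decidable HasStar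
    hasStar? E = anySubset? (λ D → (D ⊆? E) ×-dec forcedTo? x D)

    -- Deleting `x` maps the members through `x` injectively to d-sets that avoid `x` and are not
    -- missing. Together with the missing ones these are among the C(n-1,d) d-sets avoiding `x`.
    balance : # 𝓢 _∈𝓕? + # 𝓢 missing? ≤ N C d + # 𝓢 off?
    balance = begin
      # 𝓢 _∈𝓕? + # 𝓢 missing?              ≤⟨ +-monoˡ-≤ _ (#-⊎ 𝓢 _∈𝓕? through? off? split) ⟩
      # 𝓢 through? + # 𝓢 off? + # 𝓢 missing? ≤⟨ +-monoˡ-≤ _ (+-monoˡ-≤ _ (#-injection through? present? (_- x) maps inj)) ⟩
      # 𝓢 present? + # 𝓢 off? + # 𝓢 missing? ≡⟨ arrange (# 𝓢 present?) _ _ ⟩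
      # 𝓢 present? + # 𝓢 missing? + # 𝓢 off? ≤⟨ +-monoˡ-≤ _ (≤-trans
        (#-disjoint 𝓢 avoiding? present? missing? (λ _ → proj₁) (λ _ → proj₁) (λ _ (_ , E∈) (_ , E∉) → E∉ E∈))
        (#-size-avoiding x d)) ⟩
      N C d + # 𝓢 off?                        ∎
      where
      open ≤-Reasoning
      through? present? : ∀ F → Dec _
      through? F = (F ∈𝓕?) ×-dec (x ∈? F)
      present? E = avoiding? E ×-dec ((E ∪ ⁅ x ⁆) ∈𝓕?)
      split : ∀ F → F ∈𝓕 → (F ∈𝓕 × x ∈ F) ⊎ Off F
      split F F∈ with x ∈? F
      ... | yes x∈F = inj₁ (F∈ , x∈F)
      ... | no x∉F  = inj₂ (F∈ , x∉F)
      maps : ∀ F → F ∈𝓕 × x ∈ F → (x ∉ F - x × (∣ (F - x) ∣) ≡ d) × (((F - x) ∪ ⁅ x ⁆) ∈𝓕)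
      maps F (F∈ , x∈F) = (x∉p-x F x , suc-injective (trans (1+∣p-x∣≡∣p∣ x∈F) (uniform 𝓕 F F∈))) ,
        subst _∈𝓕 (sym (p-x∪x≡p x∈F)) F∈
      inj : ∀ F F′ → F ∈𝓕 × x ∈ F → F′ ∈𝓕 × x ∈ F′ → F - x ≡ F′ - x → F ≡ F′
      inj F F′ (_ , x∈F) (_ , x∈F′) e = trans (sym (p-x∪x≡p x∈F)) (trans (cong (_∪ ⁅ x ⁆) e) (p-x∪x≡p x∈F′))
      arrange : ∀ p q r → p + q + r ≡ p + r + q
      arrange = solve-∀

    offTight? offLoose? missingNoStar? missingStar? : ∀ F → Dec _
    offTight? F = tight? F ×-dec ¬? (x ∈? F)
    offLoose? F = loose? F ×-dec ¬? (x ∈? F)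
    missingNoStar? E = missing? E ×-dec ¬? (hasStar? E)
    missingStar? E = missing? E ×-dec hasStar? E

    -- If `own H` completed by `x` were a member, `own-unique` would make it `H`, which misses `x`.
    -- A set forcing `x` inside `own H` would likewise put `x` into `H`.
    offTight-bound : # 𝓢 offTight? ≤ # 𝓢 missingNoStar?
    offTight-bound = #-injection offTight? missingNoStar? own maps
      (λ H H′ (t , _) (t′ , _) → own-injective H H′ t t′)
      where
      maps : ∀ H → Tight H × x ∉ H → Missing (own H) × ¬ HasStar (own H)
      maps H (t@(H∈ , _) , x∉H) =
        (((λ x∈ → x∉H (own-⊆ t x∈)) , own-size t) ,
         (λ E∈ → x∉H (subst (x ∈_) (sym (own-unique t E∈ (p⊆p∪q ⁅ x ⁆))) (q⊆p∪q (own H) ⁅ x ⁆ (x∈⁅x⁆ x))))) ,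
        (λ (D , D⊆ , _ , _ , force) → x∉H (force H H∈ (λ y∈ → own-⊆ t (D⊆ y∈))))

    OffWitness : Subset n → Set
    OffWitness B = ∃ λ H → Off H × β H ≡ B

    offWitness? : Decidable OffWitness
    offWitness? B = anySubset? (λ H → off? H ×-dec (β H ≟ₛ B))

    offLoose-bound : # 𝓢 offLoose? ≤ # 𝓢 offWitness? * T
    offLoose-bound = #-cover 𝓢 𝓢 offLoose? offWitness? (λ G B → β G ≟ₛ B) T
      (λ H ((H∈ , _) , x∉H) → β H , ∈-subsets (β H) , (H , (H∈ , x∉H) , refl) , refl)
      bound
      where
      bound : ∀ B → OffWitness B → # 𝓢 (λ G → offLoose? G ×-dec (β G ≟ₛ B)) ≤ T
      bound B (H , (H∈ , _) , refl) = ≤-trans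
        (#-mono 𝓢 (λ G → offLoose? G ×-dec (β G ≟ₛ B)) (λ G → loose? G ×-dec (β G ≟ₛ B)) (λ G ((l , _) , e) → l , e))
        (#-loose-link B (β-size H∈))

    -- A d-set E with E ∩ H = β H cannot be completed by x inside 𝓕.  It may also be
    -- chosen to contain a set forcing x, and then it is never of the form own H.
    Q : Subset n → Subset n → Set
    Q B D = (∣ D ∣ ≡ s × Forces D x) × ∃ λ H → (Off H × β H ≡ B) × D ⊆ ∁ H

    q? : ∀ B → Decidable (Q B)
    q? B D = forcedTo? x D ×-dec anySubset? (λ H → (off? H ×-dec (β H ≟ₛ B)) ×-dec (D ⊆? ∁ H))

    -- At most |H| n^(s-1) of the sets forcing `x` meet `H`; the first term of `heavy` covers them.
    many : ∀ B → OffWitness B → c * suc (k * k) * n ^ s′ ≤ # 𝓢 (q? B)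
    many B (H , (H∈ , x∉H) , e) = +-cancelˡ-≤ (k * n ^ s′) _ _ (begin
      k * n ^ s′ + c * suc (k * k) * n ^ s′        ≡⟨ sym (*-distribʳ-+ (n ^ s′) k _) ⟩
      (k + c * suc (k * k)) * n ^ s′               ≤⟨ heavy ⟩
      # 𝓢 (forcedTo? x)                            ≤⟨ #-⊎ 𝓢 (forcedTo? x) touching? (q? B) split ⟩
      # 𝓢 touching? + # 𝓢 (q? B)                   ≤⟨ +-monoˡ-≤ _ touching-bound ⟩
      k * n ^ s′ + # 𝓢 (q? B)                      ∎)
      where
      open ≤-Reasoning
      touching? : ∀ D → Dec (∣ D ∣ ≡ s × ∃ λ z → z ∈ H × z ∈ D)
      touching? D = (∣ D ∣ ≟ s) ×-dec any? (λ z → (z ∈? H) ×-dec (z ∈? D))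
      split : ∀ D → ∣ D ∣ ≡ s × Forces D x → (∣ D ∣ ≡ s × ∃ λ z → z ∈ H × z ∈ D) ⊎ Q B D
      split D (D-size , f) with touching? D
      ... | yes t = inj₁ t
      ... | no ¬t = inj₂ ((D-size , f) , H , ((H∈ , x∉H) , e) , λ z∈D → ∈∁ (λ z∈H → ¬t (D-size , _ , z∈H , z∈D)))
      touching-bound : # 𝓢 touching? ≤ k * n ^ s′
      touching-bound = ≤-trans
        (#-cover 𝓢 (allFin n) touching? (_∈? H) (λ D z → z ∈? D) (n ^ s′)
          (λ D (_ , z , z∈H , z∈D) → z , ∈-allFin z , z∈H , z∈D)
          (λ z _ → ≤-trans
            (#-mono 𝓢 (λ D → touching? D ×-dec (z ∈? D)) (λ D → (z ∈? D) ×-dec (∣ D ∣ ≟ s)) (λ D ((D-size , _) , z∈D) → z∈D , D-size))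
            (#-through z s′)))
        (≤-reflexive (cong (_* n ^ s′) (trans (#-allFin-∈ H) (uniform 𝓕 H H∈))))

    extend : ∀ B D → OffWitness B → Q B D → ∃ λ Z → B ∪ D ⊆ ∁ Z × ∣ B ∪ D ∣ ≡ s + s × 2 * (m + (s + s + ∣ Z ∣)) ≤ n ×
      (∀ E → Between (B ∪ D) Z (s + s + m) E → Missing E × HasStar E)
    extend B D _ ((D-size , f@(x∉D , _)) , H , ((H∈ , x∉H) , refl) , D⊆∁H) =
      Z , ∪-⊆ B⊆∁Z D⊆∁Z ,
      trans (∣p∪q∣≡∣p∣+∣q∣ B D (λ y∈B → ∈∁ (λ y∈D → x∈∁p⇒x∉p (D⊆∁H y∈D) (β-⊆ H∈ y∈B)))) (cong₂ _+_ (β-size H∈) D-size) ,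
      ≤-trans (*-monoʳ-≤ 2 (+-monoʳ-≤ m (+-monoʳ-≤ (s + s) Z-size))) large ,
      inMissing
      where
      -- A set E that contains `B` and avoids this `Z` meets `H` exactly in `B` and misses `x`.
      Z = (H ─ B) ∪ ⁅ x ⁆
      x∈Z : x ∈ Z
      x∈Z = q⊆p∪q (H ─ B) ⁅ x ⁆ (x∈⁅x⁆ x)
      Z-cases : ∀ {y} → y ∈ Z → (y ∈ H × y ∉ B) ⊎ y ≡ x
      Z-cases {y} y∈Z with x∈p∪q⁻ (H ─ B) ⁅ x ⁆ y∈Z
      ... | inj₁ y∈   = inj₁ (p─q⊆p H B y∈ , ∈-─⇒∉ H B y∈)
      ... | inj₂ y∈x  = inj₂ (x∈⁅y⁆⇒x≡y x y∈x)
      B⊆∁Z : B ⊆ ∁ Z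
      B⊆∁Z y∈B = ∈∁ λ y∈Z → case-Z (Z-cases y∈Z)
        where
        case-Z : _ → _
        case-Z (inj₁ (_ , y∉B)) = y∉B y∈B
        case-Z (inj₂ refl)      = x∉H (β-⊆ H∈ y∈B)
      D⊆∁Z : D ⊆ ∁ Z
      D⊆∁Z y∈D = ∈∁ λ y∈Z → case-Z (Z-cases y∈Z)
        where
        case-Z : _ → _
        case-Z (inj₁ (y∈H , _)) = x∈∁p⇒x∉p (D⊆∁H y∈D) y∈H
        case-Z (inj₂ refl)      = x∉D y∈D
      Z-size : ∣ Z ∣ ≤ suc k
      Z-size = begin
        ∣ Z ∣                       ≤⟨ ∣p∪q∣≤∣p∣+∣q∣ (H ─ B) ⁅ x ⁆ ⟩
        ∣ H ─ B ∣ + ∣ ⁅ x ⁆ ∣       ≤⟨ +-mono-≤ (≤-trans (∣p─q∣≤∣p∣ H B) (≤-reflexive (uniform 𝓕 H H∈))) (≤-reflexive (∣⁅x⁆∣≡1 x)) ⟩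
        k + 1                       ≡⟨ +-comm k 1 ⟩
        suc k                       ∎
        where open ≤-Reasoning
      inMissing : ∀ E → Between (B ∪ D) Z (s + s + m) E → Missing E × HasStar E
      inMissing E (BD⊆E , E⊆∁Z , E-size) =
        (((λ x∈E → x∈∁p⇒x∉p (E⊆∁Z x∈E) x∈Z) , E-size) , incomplete) ,
        D , (λ y∈ → BD⊆E (q⊆p∪q B D y∈)) , D-size , f
        where
        incomplete : ¬ ((E ∪ ⁅ x ⁆) ∈𝓕)
        -- As `x` is not in `H`, adding it to E leaves the intersection with `H` equal to the
        -- witness `B`.
        incomplete E∈ with meets-outside H∈ E∈ (λ y∈ → p⊆p∪q ⁅ x ⁆ (BD⊆E (p⊆p∪q D y∈)))
        ... | y , y∈H , y∈Ex , y∉B with x∈p∪q⁻ E ⁅ x ⁆ y∈Ex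
        ...   | inj₁ y∈E = x∈∁p⇒x∉p (E⊆∁Z y∈E) (p⊆p∪q ⁅ x ⁆ (x∈p∧x∉q⇒x∈p─q y∈H y∉B))
        ...   | inj₂ y∈x = x∉H (subst (_∈ H) (x∈⁅y⁆⇒x≡y x y∈x) y∈H)

    instance
      c≢0 : NonZero c
      c≢0 = m*n≢0 (2 ^ d * 2 ^ d) (Γ m) {{m*n≢0 (2 ^ d) (2 ^ d) {{m^n≢0 2 d}} {{m^n≢0 2 d}}}} {{m*n≢0 (2 ^ m) (m !) {{m^n≢0 2 m}} {{m !≢0}}}}

    offWitness-bound : # 𝓢 offWitness? * (suc (k * k) * n ^ (s′ + m)) ≤ # 𝓢 missingStar?
    offWitness-bound = *-cancelʳ-≤ _ _ c (begin
      # 𝓢 offWitness? * (suc (k * k) * n ^ (s′ + m)) * c         ≡⟨ cong (λ z → # 𝓢 offWitness? * (suc (k * k) * z) * c) (^-distribˡ-+-* n s′ m) ⟩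
      # 𝓢 offWitness? * (suc (k * k) * (n ^ s′ * n ^ m)) * c     ≡⟨ arrange (# 𝓢 offWitness?) (suc (k * k)) (n ^ s′) (n ^ m) c ⟩
      # 𝓢 offWitness? * (c * suc (k * k) * n ^ s′ * n ^ m)       ≤⟨ pair-count offWitness? q? missingStar? (s + s) m _ many extend (λ E (((_ , e) , _) , _) → e) ⟩
      # 𝓢 missingStar? * c                                       ∎)
      where
      open ≤-Reasoning
      arrange : ∀ b t p q c → b * (t * (p * q)) * c ≡ b * (c * t * p * q)
      arrange = solve-∀

    -- Missing sets are split by whether they contain a set forcing `x`. Tight members off `x`
    -- inject into those that do not; loose ones are outnumbered by those that do.
    off-vs-missing : # 𝓢 off? ≡ 0 ⊎ # 𝓢 off? < # 𝓢 missing?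
    off-vs-missing with #-witness 𝓢 off?
    ... | inj₁ e           = inj₁ e
    ... | inj₂ (H , H-off) = inj₂ (begin-strict
      # 𝓢 off?                                         ≤⟨ #-⊎ 𝓢 off? offTight? offLoose? split ⟩
      # 𝓢 offTight? + # 𝓢 offLoose?                    ≤⟨ +-mono-≤ offTight-bound offLoose-bound ⟩
      # 𝓢 missingNoStar? + b * T                       <⟨ +-monoʳ-< (# 𝓢 missingNoStar?) loose<star ⟩
      # 𝓢 missingNoStar? + # 𝓢 missingStar?            ≤⟨ #-disjoint 𝓢 missing? missingNoStar? missingStar? (λ _ → proj₁) (λ _ → proj₁)
                                                           (λ _ (_ , ¬h) (_ , h) → ¬h h) ⟩
      # 𝓢 missing?                                     ∎)
      where
      open ≤-Reasoning
      b = # 𝓢 offWitness?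
      split : ∀ H → Off H → (Tight H × x ∉ H) ⊎ (Loose H × x ∉ H)
      split H (H∈ , x∉H) with captured? (β H)
      ... | yes cB = inj₁ ((H∈ , cB) , x∉H)
      ... | no ¬cB = inj₂ ((H∈ , ¬cB) , x∉H)
      b≥1 : 1 ≤ b
      -- `offWitness?` also counts witnesses of tight members, so `b` is positive as soon as any
      -- member misses `x`, and strictness follows even without loose members.
      b≥1 = #-positive offWitness? (∈-subsets (β H)) (H , H-off , refl)
      p = n ^ (s′ + m)
      arrange : ∀ b k p → b * p + b * (k * (k * p)) ≡ b * (suc (k * k) * p)
      arrange = solve-∀
      loose<star : b * T < # 𝓢 missingStar?
      loose<star = begin-strict
        b * T                        <⟨ m<n+m (b * T) (*-mono-≤ b≥1 (m^n>0 n (s′ + m))) ⟩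
        b * p + b * T                ≡⟨ arrange b k p ⟩
        b * (suc (k * k) * p)        ≤⟨ offWitness-bound ⟩
        # 𝓢 missingStar?             ∎

    conclusion : length (members 𝓕) ≤ N C d × (length (members 𝓕) ≡ N C d → IsStar 𝓕)
    conclusion with off-vs-missing
    ... | inj₂ lt = <⇒≤ fewer , λ e → contradiction e (<⇒≢ fewer)
      where
      open ≤-Reasoning
      fewer : length (members 𝓕) < N C d
      fewer = +-cancelʳ-< (# 𝓢 missing?) _ _ (begin-strict
        length (members 𝓕) + # 𝓢 missing?  ≤⟨ +-monoˡ-≤ _ (length≤#-∈ (unique 𝓕)) ⟩
        # 𝓢 _∈𝓕? + # 𝓢 missing?            ≤⟨ balance ⟩
        N C d + # 𝓢 off?                   <⟨ +-monoʳ-< (N C d) lt ⟩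
        N C d + # 𝓢 missing?               ∎)
    ... | inj₁ none = ≤-trans (m≤m+n _ (# 𝓢 missing?)) total , star
      where
      total : length (members 𝓕) + # 𝓢 missing? ≤ N C d
      total = ≤-trans (+-monoˡ-≤ _ (length≤#-∈ (unique 𝓕))) (≤-trans balance
        (≤-reflexive (trans (cong (N C d +_) none) (+-identityʳ _))))
      star : length (members 𝓕) ≡ N C d → IsStar 𝓕
      star e = x , λ F → mk⇔ (λ F∈ → uniform 𝓕 F F∈ , through F∈) (λ (F-size , x∈F) → present F-size x∈F)
        where
        -- At equality `balance` leaves no room for missing sets, so the star at `x` is complete.
        no-missing : # 𝓢 missing? ≤ 0
        no-missing = +-cancelˡ-≤ (N C d) _ _ (≤-trans (subst (λ z → z + # 𝓢 missing? ≤ N C d) e total) (≤-reflexive (sym (+-identityʳ _))))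
        through : ∀ {F} → F ∈𝓕 → x ∈ F
        through {F} F∈ = decidable-stable (x ∈? F) (λ x∉F →
          1+n≰n (≤-trans (#-positive off? (∈-subsets F) (F∈ , x∉F)) (≤-reflexive none)))
        present : ∀ {F} → ∣ F ∣ ≡ k → x ∈ F → F ∈𝓕
        present {F} F-size x∈F = decidable-stable (F ∈𝓕?) (λ F∉ →
          1+n≰n (≤-trans (#-positive missing? (∈-subsets (F - x))
            ((x∉p-x F x , suc-injective (trans (1+∣p-x∣≡∣p∣ x∈F) F-size)) , (λ E∈ → F∉ (subst _∈𝓕 (p-x∪x≡p x∈F) E∈)))) no-missing))

-- No point forced by many s-sets

-- Applied with p = n^(s-1), q = n^(d-2s), C₁ = C(n-1,d), C₂ = C(n,d), w a lower bound for the
-- number of partners of each forcing set, and U the number of d-sets not covered by 𝓕.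
spread-estimate : ∀ n .{{_ : NonZero n}} p .{{_ : NonZero p}} q .{{_ : NonZero q}} (g c K c₁ w γ U C₁ C₂ lo ti : ℕ) →
  C₁ ≤ lo + ti →
  lo ≤ n * p * (K * (p * q)) →
  ti ≤ γ * (n * p * q) →
  ti + U ≤ C₂ →
  C₂ ≤ p * (n * p) * q + C₁ →
  n * p * (n * p) * q ≤ g * C₁ →
  γ * (w * q) ≤ U * c →
  γ ≤ w + c₁ * p →
  2 * (g * K) ≤ n →
  4 * (g * c₁) ≤ n →
  n ≤ 8 * (g * g * c * suc K)
spread-estimate n p q g c K c₁ w γ U C₁ C₂ lo ti mass lo≤ ti≤ ti+U≤ C₂≤ C₁≥ pairs γ≤ n≥₁ n≥₂ =
  *-cancelʳ-≤ n _ (p * V) (begin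
    n * (p * V)                       ≡⟨ r₁ n p q ⟩
    (n * p) * (n * p) * q             ≤⟨ *-monoˡ-≤ q (*-mono-≤ np≤γ np≤w) ⟩
    (2 * (g * γ)) * (4 * (g * w)) * q ≡⟨ r₂ g γ w q ⟩
    8 * (g * g) * (γ * (w * q))       ≤⟨ *-monoʳ-≤ (8 * (g * g)) pairs ⟩
    8 * (g * g) * (U * c)             ≤⟨ *-monoʳ-≤ (8 * (g * g)) (*-monoˡ-≤ c U≤) ⟩
    8 * (g * g) * (suc K * (p * V) * c) ≡⟨ r₃ g c (suc K) (p * V) ⟩
    8 * (g * g * c * suc K) * (p * V) ∎)
  where
  open ≤-Reasoning
  -- `V` is n^(d-s) and `p * V` is n^(d-1), the scale of the bound on `U`.
  V = n * p * q
  instance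
    V≢0 : NonZero V
    V≢0 = m*n≢0 (n * p) q {{m*n≢0 n p}}
    pX≢0 : NonZero (p * V)
    pX≢0 = m*n≢0 p V
  r₁ : ∀ n p q → n * (p * (n * p * q)) ≡ (n * p) * (n * p) * q
  r₁ = solve-∀
  r₂ : ∀ g γ w q → (2 * (g * γ)) * (4 * (g * w)) * q ≡ 8 * (g * g) * (γ * (w * q))
  r₂ = solve-∀
  r₃ : ∀ g c t y → 8 * (g * g) * (t * y * c) ≡ 8 * (g * g * c * t) * y
  r₃ = solve-∀
  r₄ : ∀ n p q → n * p * (n * p * q) ≡ n * p * (n * p) * q
  r₄ = solve-∀
  r₅ : ∀ n p q g K γ → g * (n * p * (K * (p * q)) + γ * (n * p * q)) ≡ (g * K * p + g * γ) * (n * p * q)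
  r₅ = solve-∀
  r₆ : ∀ g K p γ → 2 * (g * K * p + g * γ) ≡ 2 * (g * K) * p + 2 * (g * γ)
  r₆ = solve-∀
  r₇ : ∀ x → 2 * x ≡ x + x
  r₇ = solve-∀
  r₈ : ∀ g w c p → 2 * (2 * (g * (w + c * p))) ≡ 4 * (g * c) * p + 4 * (g * w)
  r₈ = solve-∀
  r₉ : ∀ n p q K → n * p * (K * (p * q)) + p * (n * p) * q ≡ suc K * (p * (n * p * q))
  r₉ = solve-∀
  np≤ : n * p ≤ g * K * p + g * γ
  np≤ = *-cancelʳ-≤ (n * p) _ V (begin
    n * p * V                                          ≡⟨ r₄ n p q ⟩
    n * p * (n * p) * q                                ≤⟨ C₁≥ ⟩
    g * C₁                                             ≤⟨ *-monoʳ-≤ g (≤-trans mass (+-mono-≤ lo≤ ti≤)) ⟩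
    g * (n * p * (K * (p * q)) + γ * (n * p * q))      ≡⟨ r₅ n p q g K γ ⟩
    (g * K * p + g * γ) * V                            ∎)
  -- By `n≥₁` the loose part absorbs at most half of `n * p`, so γ is at least n^s / (2g).
  np≤γ : n * p ≤ 2 * (g * γ)
  np≤γ = +-cancelˡ-≤ (n * p) _ _ (begin
    n * p + n * p                    ≡⟨ sym (r₇ (n * p)) ⟩
    2 * (n * p)                      ≤⟨ *-monoʳ-≤ 2 np≤ ⟩
    2 * (g * K * p + g * γ)          ≡⟨ r₆ g K p γ ⟩
    2 * (g * K) * p + 2 * (g * γ)    ≤⟨ +-monoˡ-≤ _ (*-monoˡ-≤ p n≥₁) ⟩
    n * p + 2 * (g * γ)              ∎)
  -- By `n≥₂` the excluded partners again absorb at most half, so `w` is at least n^s / (4g).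
  np≤w : n * p ≤ 4 * (g * w)
  np≤w = +-cancelˡ-≤ (n * p) _ _ (begin
    n * p + n * p                       ≡⟨ sym (r₇ (n * p)) ⟩
    2 * (n * p)                         ≤⟨ *-monoʳ-≤ 2 np≤γ ⟩
    2 * (2 * (g * γ))                   ≤⟨ *-monoʳ-≤ 2 (*-monoʳ-≤ 2 (*-monoʳ-≤ g γ≤)) ⟩
    2 * (2 * (g * (w + c₁ * p)))        ≡⟨ r₈ g w c₁ p ⟩
    4 * (g * c₁) * p + 4 * (g * w)      ≤⟨ +-monoˡ-≤ _ (*-monoˡ-≤ p n≥₂) ⟩
    n * p + 4 * (g * w)                 ∎)
  -- Eliminating `ti` leaves only the difference of the two binomials and the loose part, both of
  -- order n^(d-1).
  U≤ : U ≤ suc K * (p * V)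
  U≤ = +-cancelʳ-≤ C₁ U _ (begin
    U + C₁                                               ≤⟨ +-monoʳ-≤ U mass ⟩
    U + (lo + ti)                                        ≡⟨ r U lo ti ⟩
    lo + (ti + U)                                        ≤⟨ +-mono-≤ lo≤ (≤-trans ti+U≤ C₂≤) ⟩
    n * p * (K * (p * q)) + (p * (n * p) * q + C₁)       ≡⟨ sym (+-assoc (n * p * (K * (p * q))) _ C₁) ⟩
    n * p * (K * (p * q)) + p * (n * p) * q + C₁         ≡⟨ cong (_+ C₁) (r₉ n p q K) ⟩
    suc K * (p * V) + C₁                                 ∎)
    where
    r : ∀ x y z → x + (y + z) ≡ y + (z + x)
    r = solve-∀

-- The case to be excluded: `light` and `full` together keep n below a constant, as `bounded` shows.
module Spread {N s′ m : ℕ}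
  (𝓕 : UniformFamily (suc N) (suc (suc s′ + suc s′ + m))) (witness : IsWitnessFamily (suc s′) 𝓕)
  (large : 2 * (m + (suc s′ + suc s′ + suc (suc (suc s′ + suc s′ + m)))) ≤ suc N)
  (L : ℕ) (light : ∀ x → LargeGround.starWeight 𝓕 witness large x ≤ L * suc N ^ s′)
  (full : N C (suc s′ + suc s′ + m) ≤ length (members 𝓕)) where

  open LargeGround 𝓕 witness large

  private
    n s d k : ℕ
    n = suc N
    s = suc s′
    d = s + s + m
    k = suc d

  open WitnessFamily 𝓕 witness

  sized? : Decidable (λ (B : Subset n) → ∣ B ∣ ≡ s)
  sized? B = ∣ B ∣ ≟ s

  base? : ∀ B → Dec (∣ B ∣ ≡ s × Captured B)
  base? B = sized? B ×-dec captured? B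

  loose-bound : # 𝓢 loose? ≤ n ^ s * T
  loose-bound = ≤-trans
    (#-cover 𝓢 𝓢 loose? sized? (λ G B → β G ≟ₛ B) T
      (λ G (G∈ , _) → β G , ∈-subsets (β G) , β-size G∈ , refl) #-loose-link)
    (*-monoˡ-≤ T (≤-trans (#-size n s) (nCk≤n^k n s)))

  -- A member with witness `B` contains `B` and a point that `B` forces, which leaves d - s = s + m
  -- free elements.
  tight-bound : # 𝓢 tight? ≤ # 𝓢 base? * n ^ (s + m)
  tight-bound = #-cover 𝓢 𝓢 tight? base? (λ G B → β G ≟ₛ B) (n ^ (s + m))
    (λ G (G∈ , cG) → β G , ∈-subsets (β G) , (β-size G∈ , cG) , refl)
    link
    where
    link : ∀ B → ∣ B ∣ ≡ s × Captured B → # 𝓢 (λ G → tight? G ×-dec (β G ≟ₛ B)) ≤ n ^ (s + m)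
    link B (B-size , y , y∉B , force) = ≤-trans
      (#-mono 𝓢 (λ G → tight? G ×-dec (β G ≟ₛ B)) (λ G → (Y ⊆? G) ×-dec (∣ G ∣ ≟ ∣ Y ∣ + (s + m)))
        (λ { G ((G∈ , _) , refl) → ∪-⊆ (β-⊆ G∈) (⁅⁆-⊆ (force G G∈ (β-⊆ G∈))) ,
          trans (uniform 𝓕 G G∈) (trans (cong ℕ.suc (+-assoc s s m)) (cong (_+ (s + m)) (sym Y-size))) }))
      (#-containing Y (s + m))
      where
      Y = B ∪ ⁅ y ⁆
      Y-size : ∣ Y ∣ ≡ suc s
      Y-size = trans (∣p∪⁅x⁆∣≡1+∣p∣ y∉B) (cong ℕ.suc B-size)

  Covered Uncovered : Subset n → Set
  Covered E = ∣ E ∣ ≡ d × ∃ λ F → F ∈𝓕 × E ⊆ F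
  Uncovered E = ∣ E ∣ ≡ d × ¬ (∃ λ F → F ∈𝓕 × E ⊆ F)

  extended? : ∀ E → Dec (∃ λ F → F ∈𝓕 × E ⊆ F)
  extended? E = anySubset? (λ F → (F ∈𝓕?) ×-dec (E ⊆? F))

  covered? : Decidable Covered
  covered? E = (∣ E ∣ ≟ d) ×-dec extended? E

  uncovered? : Decidable Uncovered
  uncovered? E = (∣ E ∣ ≟ d) ×-dec ¬? (extended? E)

  tight+uncovered : # 𝓢 tight? + # 𝓢 uncovered? ≤ n C d
  tight+uncovered = begin
    # 𝓢 tight? + # 𝓢 uncovered?     ≤⟨ +-monoˡ-≤ _ (#-injection tight? covered? own
                                          (λ F t → own-size t , F , proj₁ t , own-⊆ t) own-injective) ⟩
    # 𝓢 covered? + # 𝓢 uncovered?   ≤⟨ #-disjoint 𝓢 (λ E → ∣ E ∣ ≟ d) covered? uncovered? (λ _ → proj₁) (λ _ → proj₁)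
                                          (λ _ (_ , e) (_ , ¬e) → ¬e e) ⟩
    # 𝓢 (λ E → ∣ E ∣ ≟ d)           ≤⟨ #-size n d ⟩
    n C d                           ∎
    where open ≤-Reasoning

  -- Without a clash, `D` is disjoint from `B`, does not contain `x`, and forces neither `x` nor a
  -- point of `B`.
  Clash : Subset n → Subset n → Fin n → Set
  Clash B D x = ∃ λ z → z ∈ B ∪ ⁅ x ⁆ × (z ∈ D ⊎ Forces D z)

  clash? : ∀ B D x → Dec (Clash B D x)
  clash? B D x = any? (λ z → (z ∈? (B ∪ ⁅ x ⁆)) ×-dec ((z ∈? D) ⊎-dec forces? D z))

  Q : Subset n → Subset n → Set
  Q B D = (∣ D ∣ ≡ s × Captured D) × ∃ λ x → Forces B x × ¬ Clash B D x

  q? : ∀ B → Decidable (Q B)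
  q? B D = base? D ×-dec any? (λ x → forces? B x ×-dec ¬? (clash? B D x))

  -- Each of the s + 1 points of B ∪ {x} lies in at most n^(s-1) sets D and, by `light`, is forced
  -- by at most L n^(s-1) of them.
  many′ : ∀ B → ∣ B ∣ ≡ s × Captured B → # 𝓢 base? ≤ # 𝓢 (q? B) + suc s * suc L * n ^ s′
  many′ B (B-size , x , f@(x∉B , _)) = begin
    # 𝓢 base?                                ≤⟨ #-⊎ 𝓢 base? (q? B) clashing? split ⟩
    # 𝓢 (q? B) + # 𝓢 clashing?               ≤⟨ +-monoʳ-≤ _ clashing-bound ⟩
    # 𝓢 (q? B) + suc s * (suc L * n ^ s′)    ≡⟨ cong (# 𝓢 (q? B) +_) (sym (*-assoc (suc s) (suc L) _)) ⟩
    # 𝓢 (q? B) + suc s * suc L * n ^ s′      ∎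
    where
    open ≤-Reasoning
    clashing? : ∀ D → Dec (∣ D ∣ ≡ s × Clash B D x)
    clashing? D = sized? D ×-dec clash? B D x
    split : ∀ D → ∣ D ∣ ≡ s × Captured D → Q B D ⊎ (∣ D ∣ ≡ s × Clash B D x)
    split D (D-size , cD) with clash? B D x
    ... | yes cl = inj₂ (D-size , cl)
    ... | no ¬cl = inj₁ ((D-size , cD) , x , f , ¬cl)
    through : ∀ z → z ∈ B ∪ ⁅ x ⁆ → # 𝓢 (λ D → clashing? D ×-dec ((z ∈? D) ⊎-dec forces? D z)) ≤ suc L * n ^ s′
    through z _ = begin
      # 𝓢 (λ D → clashing? D ×-dec ((z ∈? D) ⊎-dec forces? D z))
        ≤⟨ #-⊎ 𝓢 (λ D → clashing? D ×-dec ((z ∈? D) ⊎-dec forces? D z)) (λ D → (z ∈? D) ×-dec sized? D) (forcedTo? z)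
             (λ { D ((e , _) , inj₁ z∈) → inj₁ (z∈ , e) ; D ((e , _) , inj₂ g) → inj₂ (e , g) }) ⟩
      # 𝓢 (λ D → (z ∈? D) ×-dec sized? D) + # 𝓢 (forcedTo? z)
        ≤⟨ +-mono-≤ (#-through z s′) (light z) ⟩
      n ^ s′ + L * n ^ s′ ∎
    clashing-bound : # 𝓢 clashing? ≤ suc s * (suc L * n ^ s′)
    clashing-bound = ≤-trans
      (#-cover 𝓢 (allFin n) clashing? (_∈? (B ∪ ⁅ x ⁆)) (λ D z → (z ∈? D) ⊎-dec forces? D z) (suc L * n ^ s′)
        (λ D (_ , z , z∈ , h) → z , ∈-allFin z , z∈ , h) through)
      (≤-reflexive (cong (_* (suc L * n ^ s′)) (trans (#-allFin-∈ (B ∪ ⁅ x ⁆)) (trans (∣p∪⁅x⁆∣≡1+∣p∣ x∉B) (cong ℕ.suc B-size)))))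

  -- A member above such an E contains `B` and `D`, hence also the distinct points `x` and `y` they
  -- force, both outside E. That makes d + 2 elements, one too many.
  extend : ∀ B D → ∣ B ∣ ≡ s × Captured B → Q B D → ∃ λ Z → B ∪ D ⊆ ∁ Z × ∣ B ∪ D ∣ ≡ s + s × 2 * (m + (s + s + ∣ Z ∣)) ≤ n ×
    (∀ E → Between (B ∪ D) Z (s + s + m) E → Uncovered E)
  extend B D (B-size , _) ((D-size , y , y∉D , y-force) , x , (x∉B , x-force) , ¬clash) =
    Z , ∪-⊆ B⊆∁Z D⊆∁Z ,
    trans (∣p∪q∣≡∣p∣+∣q∣ B D (λ z∈B → ∈∁ (λ z∈D → ¬clash (_ , p⊆p∪q ⁅ x ⁆ z∈B , inj₁ z∈D)))) (cong₂ _+_ B-size D-size) ,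
    ≤-trans (*-monoʳ-≤ 2 (+-monoʳ-≤ m (+-monoʳ-≤ (s + s) Z-size))) large ,
    uncovered
    where
    Z = ⁅ x ⁆ ∪ ⁅ y ⁆
    x∈Bx : x ∈ B ∪ ⁅ x ⁆
    x∈Bx = q⊆p∪q B ⁅ x ⁆ (x∈⁅x⁆ x)
    y∉Bx : y ∉ B ∪ ⁅ x ⁆
    y∉Bx y∈ = ¬clash (y , y∈ , inj₂ (y∉D , y-force))
    avoids : ∀ {p : Subset n} → x ∉ p → y ∉ p → p ⊆ ∁ Z
    avoids {p} x∉p y∉p {z} z∈p = ∈∁ λ z∈Z → case-Z (x∈p∪q⁻ ⁅ x ⁆ ⁅ y ⁆ z∈Z)
      where
      case-Z : _ → _
      case-Z (inj₁ z∈x) = x∉p (subst (_∈ p) (x∈⁅y⁆⇒x≡y x z∈x) z∈p)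
      case-Z (inj₂ z∈y) = y∉p (subst (_∈ p) (x∈⁅y⁆⇒x≡y y z∈y) z∈p)
    B⊆∁Z : B ⊆ ∁ Z
    B⊆∁Z = avoids x∉B (λ y∈B → y∉Bx (p⊆p∪q ⁅ x ⁆ y∈B))
    D⊆∁Z : D ⊆ ∁ Z
    D⊆∁Z = avoids (λ x∈D → ¬clash (x , x∈Bx , inj₁ x∈D)) y∉D
    Z-size : ∣ Z ∣ ≤ suc k
    Z-size = ≤-trans (∣p∪q∣≤∣p∣+∣q∣ ⁅ x ⁆ ⁅ y ⁆) (≤-trans (≤-reflexive (cong₂ _+_ (∣⁅x⁆∣≡1 x) (∣⁅x⁆∣≡1 y))) (s≤s (s≤s z≤n)))
    uncovered : ∀ E → Between (B ∪ D) Z (s + s + m) E → Uncovered E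
    uncovered E (BD⊆E , E⊆∁Z , E-size) = E-size , too-big
      where
      x∉E : x ∉ E
      x∉E x∈E = x∈∁p⇒x∉p (E⊆∁Z x∈E) (p⊆p∪q ⁅ y ⁆ (x∈⁅x⁆ x))
      y∉Ex : y ∉ E ∪ ⁅ x ⁆
      y∉Ex y∈ with x∈p∪q⁻ E ⁅ x ⁆ y∈
      ... | inj₁ y∈E = x∈∁p⇒x∉p (E⊆∁Z y∈E) (q⊆p∪q ⁅ x ⁆ ⁅ y ⁆ (x∈⁅x⁆ y))
      ... | inj₂ y∈x = y∉Bx (q⊆p∪q B ⁅ x ⁆ y∈x)
      too-big : ¬ (∃ λ F → F ∈𝓕 × E ⊆ F)
      too-big (F , F∈ , E⊆F) = 1+n≰n (begin
        suc k                            ≡⟨ cong (ℕ.suc ∘ ℕ.suc) (sym E-size) ⟩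
        suc (suc ∣ E ∣)                  ≡⟨ sym (trans (∣p∪⁅x⁆∣≡1+∣p∣ y∉Ex) (cong ℕ.suc (∣p∪⁅x⁆∣≡1+∣p∣ x∉E))) ⟩
        ∣ (E ∪ ⁅ x ⁆) ∪ ⁅ y ⁆ ∣          ≤⟨ p⊆q⇒∣p∣≤∣q∣ (∪-⊆ (∪-⊆ E⊆F (⁅⁆-⊆ (x-force F F∈ B⊆F))) (⁅⁆-⊆ (y-force F F∈ D⊆F))) ⟩
        ∣ F ∣                            ≡⟨ uniform 𝓕 F F∈ ⟩
        k                                ∎)
        where
        open ≤-Reasoning
        B⊆F : B ⊆ F
        B⊆F z∈ = E⊆F (BD⊆E (p⊆p∪q D z∈))
        D⊆F : D ⊆ F
        D⊆F z∈ = E⊆F (BD⊆E (q⊆p∪q B D z∈))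

  γ = # 𝓢 base?
  c₁ = suc s * suc L
  -- Guaranteed number of partners of a forcing set. Truncation is harmless: zero is still a valid
  -- lower bound, and γ ≤ w + c₁ n^(s-1) holds in either case.
  w = γ ∸ c₁ * n ^ s′

  bounded : 2 * (Γ d * (k * k)) ≤ n → 4 * (Γ d * c₁) ≤ n → n ≤ 8 * (Γ d * Γ d * c * suc (k * k))
  bounded = spread-estimate n (n ^ s′) {{m^n≢0 n s′}} (n ^ m) {{m^n≢0 n m}} (Γ d) c (k * k) c₁ w γ (# 𝓢 uncovered?) (N C d) (n C d) (# 𝓢 loose?) (# 𝓢 tight?)
    mass
    (≤-trans loose-bound (≤-reflexive (cong (n * n ^ s′ *_) (trans (sym (*-assoc k k (n ^ (s′ + m)))) (cong (k * k *_) (^-distribˡ-+-* n s′ m))))))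
    (≤-trans tight-bound (≤-reflexive (cong (γ *_) (^-distribˡ-+-* n s m))))
    tight+uncovered
    pascal
    (≤-trans (≤-reflexive (sym (trans (^-distribˡ-+-* n (s + s) m) (cong (_* n ^ m) (^-distribˡ-+-* n s s))))) (n^k≤Γ*rCk n N d small))
    (pair-count base? q? uncovered? (s + s) m w
      (λ B b → m≤n+o⇒m∸o≤n′ (many′ B b)) extend (λ E → proj₁))
    (≤-trans (m≤n+m∸n γ (c₁ * n ^ s′)) (≤-reflexive (+-comm (c₁ * n ^ s′) w)))
    where
    m≤n+o⇒m∸o≤n′ : ∀ {x y z} → x ≤ y + z → x ∸ z ≤ y
    m≤n+o⇒m∸o≤n′ {x} {y} {z} h = m≤n+o⇒m∸n≤o x z (≤-trans h (≤-reflexive (+-comm y z)))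
    mass : N C d ≤ # 𝓢 loose? + # 𝓢 tight?
    mass = ≤-trans full (≤-trans (length≤#-∈ (unique 𝓕)) (#-⊎ 𝓢 _∈𝓕? loose? tight? split))
      where
      split : ∀ F → F ∈𝓕 → Loose F ⊎ Tight F
      split F F∈ with captured? (β F)
      ... | yes cF = inj₂ (F∈ , cF)
      ... | no ¬cF = inj₁ (F∈ , ¬cF)
    -- C(n,d) exceeds C(n-1,d) by C(n-1,d-1), which is at most n^(d-1).
    pascal : n C d ≤ n ^ s′ * (n * n ^ s′) * n ^ m + N C d
    pascal = begin
      n C d                          ≡⟨ sym (nCk+nC[k+1]≡[n+1]C[k+1] N (s′ + s + m)) ⟩
      N C (s′ + s + m) + N C d       ≤⟨ +-monoˡ-≤ _ (≤-trans (nCk≤n^k N (s′ + s + m)) (^-monoˡ-≤ (s′ + s + m) (n≤1+n N))) ⟩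
      n ^ (s′ + s + m) + N C d       ≡⟨ cong (_+ N C d) (trans (^-distribˡ-+-* n (s′ + s) m) (cong (_* n ^ m) (^-distribˡ-+-* n s′ s))) ⟩
      n ^ s′ * n ^ s * n ^ m + N C d ∎
      where open ≤-Reasoning
    -- With this room C(n-1,d) is at least n^d / Γ d.
    small : d + d + n ≤ N + N
    small = begin
      d + d + suc N          ≡⟨ +-suc (d + d) N ⟩
      suc (d + d) + N        ≤⟨ +-monoˡ-≤ N (s≤s⁻¹ (begin
        2 + (d + d)                            ≤⟨ m≤m+n _ _ ⟩
        2 + (d + d) + (2 + 2 * (m + (s + s)))  ≡⟨ arrange m (s + s) d ⟩
        2 * (m + (s + s + suc k))              ≤⟨ large ⟩
        n                                      ∎)) ⟩
      N + N                  ∎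
      where
      open ≤-Reasoning
      arrange : ∀ m t d → 2 + (d + d) + (2 + 2 * (m + t)) ≡ 2 * (m + (t + suc (suc d)))
      arrange = solve-∀

-- Choice of the threshold and conclusion

theorem1p4 : (d s : ℕ) → 1 ≤ s → 2 * s ≤ d →
    Σ ℕ λ n₀ → ∀ n → n₀ ≤ n → (𝓕 : UniformFamily n (suc d)) → IsWitnessFamily s 𝓕 →
    (length (members 𝓕) ≤ (n ∸ 1) C d) ×
    (length (members 𝓕) ≡ (n ∸ 1) C d → IsStar 𝓕)
theorem1p4 d (suc s′) _ 2s≤d = threshold , large-ground d (trans (sym (m+[n∸m]≡n 2s≤d)) (cong (_+ m) double))
  where
  s = suc s′
  m = d ∸ 2 * s
  k L size first second third threshold : ℕ
  k = suc (s + s + m)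
  -- The constant of `heavy`, so that every point is either heavy or light.
  L = k + 2 ^ (s + s + m) * 2 ^ (s + s + m) * Γ m * suc (k * k)
  -- `size` gives `large`, `first` and `second` give the hypotheses of `bounded`, and the `suc` in
  -- `threshold` pushes n beyond the bound `third`.
  size = 2 * (m + (s + s + suc k))
  first = 2 * (Γ (s + s + m) * (k * k))
  second = 4 * (Γ (s + s + m) * (suc s * suc L))
  third = 8 * (Γ (s + s + m) * Γ (s + s + m) * (2 ^ (s + s + m) * 2 ^ (s + s + m) * Γ m) * suc (k * k))
  threshold = size + (first + (second + suc third))
  double : 2 * s ≡ s + s
  double = cong (s +_) (+-identityʳ s)
  -- `d` is generalised with an equation so that matching on `refl` gives it the form s + s + m used
  -- by the modules.
  large-ground : ∀ d → d ≡ s + s + m → ∀ n → threshold ≤ n → (𝓕 : UniformFamily n (suc d)) → IsWitnessFamily s 𝓕 →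
    (length (members 𝓕) ≤ (n ∸ 1) C d) × (length (members 𝓕) ≡ (n ∸ 1) C d → IsStar 𝓕)
  large-ground d refl zero n₀≤0 =
    contradiction (m+n≤o⇒n≤o second (m+n≤o⇒n≤o first (m+n≤o⇒n≤o size n₀≤0))) λ ()
  large-ground d refl (suc N) n₀≤n 𝓕 witness = by-size
    where
    large = m+n≤o⇒m≤o size n₀≤n
    rest₁ = m+n≤o⇒n≤o size n₀≤n
    rest₂ = m+n≤o⇒n≤o first rest₁
    open LargeGround 𝓕 witness large
    by-size : _
    by-size with N C d ≤? length (members 𝓕) | any? (λ x → L * suc N ^ s′ ≤? starWeight x)
    ... | no few   | _               = <⇒≤ (≰⇒> few) , λ e → contradiction (≤-reflexive (sym e)) few
    ... | yes _    | yes (x , heavy) = Concentrated.conclusion x heavy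
    ... | yes full | no light        = contradiction
      (Spread.bounded 𝓕 witness large L (λ x → <⇒≤ (≰⇒> (λ heavy → light (x , heavy)))) full
        (m+n≤o⇒m≤o first rest₁) (m+n≤o⇒m≤o second rest₂))
      (<⇒≱ (m+n≤o⇒n≤o second rest₂))
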